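{- Let $X$ be a 1-walk regular graph with clique number $\omega$. For a graph $Y$ on at most $\omega$ vertices and an injective map $\iota:V(Y)\to V(X)$ whose image is a clique of $X$, let $X_{Y,\iota}$ denote the graph obtained from $X$ by deleting the edges $\{\iota(a),\iota(b)\}$ for all edges $\{a,b\}$ of $Y$. (a) If $Y_1$ and $Y_2$ are two Laplacian cospectral graphs on at most $\omega$ vertices, then for any injective maps $\iota_1:V(Y_1)\to V(X)$, $\iota_2:V(Y_2)\to V(X)$ with images cliques of $X$, the graphs $X_{Y_1,\iota_1}$ and $X_{Y_2,\iota_2}$ are Laplacian cospectral. (b) If $Y_1$ and $Y_2$ are two graphs on at most $\omega$ vertices that are unsigned Laplacian cospectral and whose complements are also unsigned Laplacian cospectral, then for any injective maps $\iota_1:V(Y_1)\to V(X)$, $\iota_2:V(Y_2)\to V(X)$ with images cliques of $X$, the graphs $X_{Y_1,\iota_1}$ and $X_{Y_2,\iota_2}$ are unsigned Laplacian cospectral.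
   Context: A graph is 1-walk regular if for every positive integer $k$ the number of closed walks of length $k$ at a vertex is the same for all vertices, and the number of walks of length $k$ from $u$ to $v$ is the same for all pairs of adjacent vertices $u,v$. The clique number is the largest size of a set of pairwise adjacent vertices. Laplacian $L=D-A$, unsigned Laplacian $S=D+A$ ($A$ adjacency matrix, $D$ diagonal degree matrix); cospectral with respect to a matrix means equal characteristic polynomials. -}

module Defs where

open import Data.Bool using (Bool; true; false; _∧_; _∨_; not; if_then_else_)
open import Data.Nat using (ℕ; zero; suc; _+_; _*_; _≤_)
open import Data.Integer as ℤ using (ℤ; +_)
open import Data.Fin using (Fin; zero; suc; punchIn; toℕ)
open import Data.Fin.Properties using (_≟_)
open import Data.List using (List; []; _∷_)
open import Data.Product using (Σ; _×_; _,_)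
open import Relation.Nullary using (¬_; does)
open import Relation.Binary.PropositionalEquality using (_≡_; refl; cong; cong₂)
open import Data.Bool.Properties using (∨-comm; ∧-zeroʳ)
open import Function.Definitions using (Injective)
import Data.Empty
import Relation.Nullary
import Relation.Binary.PropositionalEquality

record Graph (n : ℕ) : Set where
  field
    adj   : Fin n → Fin n → Bool
    sym   : ∀ u v → adj u v ≡ adj v u
    irrefl : ∀ u → adj u u ≡ false
open Graph public

Adj : ∀ {n} → Graph n → Fin n → Fin n → Set
Adj G u v = adj G u v ≡ true

_==_ : ∀ {n} → Fin n → Fin n → Bool
u == v = does (u ≟ v)

==-refl : ∀ {n} (u : Fin n) → (u == u) ≡ true
==-refl u with u ≟ u
... | Relation.Nullary.yes _ = refl
... | Relation.Nullary.no ¬p = Data.Empty.⊥-elim (¬p refl)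

==-sym : ∀ {n} (u v : Fin n) → (u == v) ≡ (v == u)
==-sym u v with u ≟ v | v ≟ u
... | Relation.Nullary.yes _ | Relation.Nullary.yes _ = refl
... | Relation.Nullary.no _  | Relation.Nullary.no _  = refl
... | Relation.Nullary.yes p | Relation.Nullary.no ¬q = Data.Empty.⊥-elim (¬q (Relation.Binary.PropositionalEquality.sym p))
... | Relation.Nullary.no ¬p | Relation.Nullary.yes q = Data.Empty.⊥-elim (¬p (Relation.Binary.PropositionalEquality.sym q))

sumℕ : ∀ {n} → (Fin n → ℕ) → ℕ
sumℕ {zero}  f = 0
sumℕ {suc n} f = f zero + sumℕ (λ i → f (suc i))

anyFin : ∀ {n} → (Fin n → Bool) → Bool
anyFin {zero}  f = false
anyFin {suc n} f = if f zero then true else anyFin (λ i → f (suc i))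

b2n : Bool → ℕ
b2n true = 1
b2n false = 0

walks : ∀ {n} → Graph n → ℕ → Fin n → Fin n → ℕ
walks G zero    u v = b2n (u == v)
walks G (suc k) u v = sumℕ (λ w → b2n (adj G u w) * walks G k w v)

OneWalkRegular : ∀ {n} → Graph n → Set
OneWalkRegular G =
  (∀ k → 1 ≤ k → ∀ u v → walks G k u u ≡ walks G k v v) ×
  (∀ k → 1 ≤ k → ∀ u v u′ v′ → Adj G u v → Adj G u′ v′ →
     walks G k u v ≡ walks G k u′ v′)

IsCliqueMap : ∀ {n m} → Graph n → (Fin m → Fin n) → Set
IsCliqueMap G f = Injective _≡_ _≡_ f × (∀ a b → ¬ (a ≡ b) → Adj G (f a) (f b))

CliqueNumber : ∀ {n} → Graph n → ℕ → Set
CliqueNumber {n} G ω =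
  Σ (Fin ω → Fin n) (IsCliqueMap G) ×
  (∀ m (f : Fin m → Fin n) → IsCliqueMap G f → m ≤ ω)

CliqueEmbedding : ∀ {n m} → Graph n → (Fin m → Fin n) → Set
CliqueEmbedding X ι = Injective _≡_ _≡_ ι × (∀ a b → ¬ (a ≡ b) → Adj X (ι a) (ι b))

hitEdge : ∀ {n m} → Graph m → (Fin m → Fin n) → Fin n → Fin n → Bool
hitEdge Y ι u v = anyFin (λ a → anyFin (λ b → adj Y a b ∧ ((ι a == u) ∧ (ι b == v))))

deleteAdj : ∀ {n m} → Graph n → Graph m → (Fin m → Fin n) → Fin n → Fin n → Bool
deleteAdj X Y ι u v = adj X u v ∧ not (hitEdge Y ι u v ∨ hitEdge Y ι v u)

deleteEdges : ∀ {n m} → Graph n → Graph m → (Fin m → Fin n) → Graph n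
deleteEdges X Y ι = record
  { adj    = deleteAdj X Y ι
  ; sym    = λ u v → cong₂ (λ p q → p ∧ not q) (Graph.sym X u v) (∨-comm (hitEdge Y ι u v) (hitEdge Y ι v u))
  ; irrefl = λ u → cong (λ p → p ∧ not (hitEdge Y ι u u ∨ hitEdge Y ι u u)) (Graph.irrefl X u)
  }

complement : ∀ {n} → Graph n → Graph n
complement G = record
  { adj    = λ u v → not (adj G u v) ∧ not (u == v)
  ; sym    = λ u v → cong₂ (λ p q → not p ∧ not q) (Graph.sym G u v) (==-sym u v)
  ; irrefl = λ u → Relation.Binary.PropositionalEquality.trans (cong (λ q → not (adj G u u) ∧ not q) (==-refl u)) (∧-zeroʳ (not (adj G u u)))
  }

-- Integer polynomials (coefficient lists, lowest degree first)

Poly : Set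
Poly = List ℤ

coeff : Poly → ℕ → ℤ
coeff []       i       = + 0
coeff (a ∷ p)  zero    = a
coeff (a ∷ p)  (suc i) = coeff p i

_≈P_ : Poly → Poly → Set
p ≈P q = ∀ i → coeff p i ≡ coeff q i

_+P_ : Poly → Poly → Poly
[]      +P q       = q
(a ∷ p) +P []      = a ∷ p
(a ∷ p) +P (b ∷ q) = (a ℤ.+ b) ∷ (p +P q)

scaleP : ℤ → Poly → Poly
scaleP c []      = []
scaleP c (a ∷ p) = (c ℤ.* a) ∷ scaleP c p

negP : Poly → Poly
negP = scaleP (ℤ.- (+ 1))

_*P_ : Poly → Poly → Poly
[]      *P q = []
(a ∷ p) *P q = scaleP a q +P (+ 0 ∷ (p *P q))

constP : ℤ → Poly
constP c = c ∷ []

varP : Poly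
varP = + 0 ∷ + 1 ∷ []

altP : ℕ → Poly → Poly
altP zero    p = p
altP (suc j) p = negP (altP j p)

sumP : ∀ {n} → (Fin n → Poly) → Poly
sumP {zero}  f = []
sumP {suc n} f = f zero +P sumP (λ i → f (suc i))

det : ∀ n → (Fin n → Fin n → Poly) → Poly
det zero    M = constP (+ 1)
det (suc n) M =
  sumP (λ j → altP (toℕ j) (M zero j *P det n (λ r c → M (suc r) (punchIn j c))))

charPoly : ∀ n → (Fin n → Fin n → ℤ) → Poly
charPoly n M = det n (λ u v → if u == v then varP +P constP (ℤ.- M u v) else constP (ℤ.- M u v))

degree : ∀ {n} → Graph n → Fin n → ℕ
degree G u = sumℕ (λ w → b2n (adj G u w))

adjℤ : ∀ {n} → Graph n → Fin n → Fin n → ℤ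
adjℤ G u v = + b2n (adj G u v)

degℤ : ∀ {n} → Graph n → Fin n → Fin n → ℤ
degℤ G u v = if u == v then + degree G u else + 0

laplacian : ∀ {n} → Graph n → Fin n → Fin n → ℤ
laplacian G u v = degℤ G u v ℤ.- adjℤ G u v

signlessLaplacian : ∀ {n} → Graph n → Fin n → Fin n → ℤ
signlessLaplacian G u v = degℤ G u v ℤ.+ adjℤ G u v

LaplacianCospectral : ∀ {n m} → Graph n → Graph m → Set
LaplacianCospectral {n} {m} G H = charPoly n (laplacian G) ≈P charPoly m (laplacian H)

UnsignedLaplacianCospectral : ∀ {n m} → Graph n → Graph m → Set
UnsignedLaplacianCospectral {n} {m} G H =
  charPoly n (signlessLaplacian G) ≈P charPoly m (signlessLaplacian H)

{-# OPTIONS --safe #-}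

-- Let M be D - A or D + A, and work over ℤ[[t]], where det (I - t M) determines the characteristic
-- polynomial of M. Deleting Y changes M(X) to M(X) - P M(Y) Pᵀ, with P the 0/1 matrix of ι. A 1-walk
-- regular graph is regular, so the coefficients of G = (I - t M(X))⁻¹ = Σ tʲ M(X)ʲ are polynomials in A,
-- hence are constant on the diagonal and on the edges: Pᵀ G P = a I + b J on any clique. Therefore
--   det (I - t M(X_Y)) = det (I - t M(X)) · det (I + t (a I + b J) M(Y)).
-- For the Laplacian, J M(Y) = 0 and the last factor is read off the characteristic polynomial of M(Y).
-- For the unsigned Laplacian, put N = I + α M(Y) with α = t a. The function F(v) = det (N + 1 vᵀ) - det N
-- is linear in v. The complement gives det (N - α J), hence α F(1), and det ((I + J) N) gives
-- F(1) + α F(M(Y) 1); so F(M(Y) 1), and with it the last factor, is determined.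
module Submission where

open import Defs hiding (det; sym)
import Defs
open import Algebra.Bundles using (CommutativeRing)
open import Algebra.Morphism.Structures using (module RingMorphisms)
import Algebra.Solver.Ring as RingSolver
open import Algebra.Solver.Ring.AlmostCommutativeRing using (fromCommutativeRing; _-Raw-AlmostCommutative⟶_)
open import Data.Bool using (Bool; true; false; if_then_else_; _∧_; _∨_; not)
open import Data.Bool.Properties using (∧-zeroʳ; ∧-identityʳ; ∨-idem)
open import Data.Fin using (Fin; zero; suc; punchIn; toℕ; _↑ˡ_; _↑ʳ_)
open import Data.Fin.Properties using (_≟_; any?; suc-injective)
open import Data.Integer as ℤ using (ℤ; 0ℤ; 1ℤ)
import Data.Integer.Properties as ℤ
open import Data.Integer.Tactic.RingSolver using (solve-∀)
open import Data.List using ([]; _∷_)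
open import Data.Maybe as Maybe using (Maybe)
open import Data.Nat as ℕ using (ℕ; zero; suc; s≤s; z≤n; _≤_)
import Data.Nat.Properties as ℕ
open import Data.Product using (∃; ∃₂; _×_; _,_; proj₁; proj₂)
open import Data.Vec using (Vec; []; _∷_; replicate)
open import Function using (_∘_)
open import Function.Definitions using (Injective)
open import Level using (0ℓ)
open import Relation.Binary using (tri<; tri≈; tri>)
open import Relation.Binary.PropositionalEquality as ≡ using (_≡_; _≢_; cong; cong₂; module ≡-Reasoning)
open import Relation.Nullary using (contradiction; yes; no)
open import Relation.Nullary.Decidable using (dec⇒maybe; dec-false)
open RingMorphisms using (IsRingHomomorphism)

-- Determinants through the exterior algebra

-- Two obstacles shape the proof. A determinant is given only as an expansion along the first row,
-- so both its multiplicativity and det (I + PQ) = det (I + QP) have to be established. They rest on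
-- one fact: the wedge of the rows of MB is det M times the wedge of the rows of B. No division
-- occurs, so this holds over every commutative ring. The other obstacle is cancellation: F(1) is
-- obtained only multiplied by α, and F(M(Y) 1) only multiplied by α². In ℤ[[t]] the factor α = t a
-- is not a unit, but it can be cancelled because a has constant term 1. Power series also provide
-- the resolvent without fractions. Characteristic polynomials enter through the homogeneous form
-- det (u I - v M), whose values at all u, v in a ring are fixed by the coefficients. The complement
-- Yᶜ needs a value of u other than 1, since M(Y) + M(Yᶜ) = (m - 2) I + J for the unsigned
-- Laplacian. Finally, cospectral graphs have equally many vertices because their characteristic
-- polynomials are monic.

module LinearAlgebra {c ℓ} (R : CommutativeRing c ℓ) where
  open CommutativeRing R hiding (zero)
  open import Algebra.Properties.Ring ring
  open import Algebra.Properties.Semiring.Sum semiring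
  open import Algebra.Properties.CommutativeSemigroup +-commutativeSemigroup using (interchange)
  open import Algebra.Properties.CommutativeSemigroup *-commutativeSemigroup using (x∙yz≈y∙xz)
  open import Relation.Binary.Reasoning.Setoid setoid

  -- Matrices and determinants over a commutative ring

  Vector : ℕ → Set c
  Vector k = Fin k → Carrier

  Matrix : ℕ → ℕ → Set c
  Matrix m n = Fin m → Fin n → Carrier

  infix 4 _≋_
  _≋_ : ∀ {m n} → Matrix m n → Matrix m n → Set ℓ
  A ≋ B = ∀ i j → A i j ≈ B i j

  infixl 6 _⊞_
  _⊞_ : ∀ {m n} → Matrix m n → Matrix m n → Matrix m n
  (A ⊞ B) i j = A i j + B i j

  infixl 7 _⊠_
  _⊠_ : ∀ {m k n} → Matrix m k → Matrix k n → Matrix m n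
  (A ⊠ B) i j = ∑[ l < _ ] (A i l * B l j)

  infixl 8 _·_
  _·_ : ∀ {m n} → Carrier → Matrix m n → Matrix m n
  (x · A) i j = x * A i j

  𝟙 : ∀ {n} → Matrix n n
  𝟙 i j = if i == j then 1# else 0#

  alternate : ℕ → Carrier → Carrier
  alternate zero    x = x
  alternate (suc j) x = - alternate j x

  det : ∀ n → Matrix n n → Carrier
  det zero    M = 1#
  det (suc n) M =
    ∑[ j < suc n ] alternate (toℕ j) (M zero j * det n (λ r c → M (suc r) (punchIn j c)))

  alternate-cong : ∀ j {x y} → x ≈ y → alternate j x ≈ alternate j y
  alternate-cong zero    e = e
  alternate-cong (suc j) e = -‿cong (alternate-cong j e)

  alternate-*ʳ : ∀ j x y → alternate j x * y ≈ alternate j (x * y)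
  alternate-*ʳ zero    x y = refl
  alternate-*ʳ (suc j) x y = trans (sym (-‿distribˡ-* _ _)) (-‿cong (alternate-*ʳ j x y))

  alternate-*ˡ : ∀ j x y → x * alternate j y ≈ alternate j (x * y)
  alternate-*ˡ j x y = trans (*-comm _ _) (trans (alternate-*ʳ j y x) (alternate-cong j (*-comm y x)))

  det-cong : ∀ n {A B : Matrix n n} → A ≋ B → det n A ≈ det n B
  det-cong zero    e = refl
  det-cong (suc n) e = sum-cong-≋ λ j → alternate-cong (toℕ j)
    (*-cong (e zero j) (det-cong n (λ r c → e (suc r) (punchIn j c))))

  sum-𝟙ˡ : ∀ {n} (f : Vector n) i → ∑[ j < n ] (𝟙 i j * f j) ≈ f i
  sum-𝟙ˡ {suc n} f zero = begin
    1# * f zero + ∑[ j < n ] (0# * f (suc j)) ≈⟨ +-cong (*-identityˡ _) (sum-cong-≋ {n} λ j → zeroˡ _) ⟩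
    f zero + ∑[ j < n ] 0#                    ≈⟨ +-congˡ (sum-replicate-zero n) ⟩
    f zero + 0#                               ≈⟨ +-identityʳ _ ⟩
    f zero                                    ∎
  sum-𝟙ˡ {suc n} f (suc i) = trans (+-cong (zeroˡ _) (sum-𝟙ˡ (f ∘ suc) i)) (+-identityˡ _)

  𝟙-sym : ∀ {n} (i j : Fin n) → 𝟙 i j ≈ 𝟙 j i
  𝟙-sym zero    zero    = refl
  𝟙-sym zero    (suc j) = refl
  𝟙-sym (suc i) zero    = refl
  𝟙-sym (suc i) (suc j) = 𝟙-sym i j

  sum-𝟙ʳ : ∀ {n} (f : Vector n) i → ∑[ j < n ] (f j * 𝟙 j i) ≈ f i
  sum-𝟙ʳ f i = trans (sum-cong-≋ λ j → trans (*-comm _ _) (*-congʳ (𝟙-sym j i))) (sum-𝟙ˡ f i)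

  ⊠-cong : ∀ {m k n} {A A′ : Matrix m k} {B B′ : Matrix k n} → A ≋ A′ → B ≋ B′ → A ⊠ B ≋ A′ ⊠ B′
  ⊠-cong e f i j = sum-cong-≋ λ l → *-cong (e i l) (f l j)

  ⊠-congˡ : ∀ {m k n} (A : Matrix m k) {B B′ : Matrix k n} → B ≋ B′ → A ⊠ B ≋ A ⊠ B′
  ⊠-congˡ A = ⊠-cong {A = A} (λ _ _ → refl)

  ⊠-congʳ : ∀ {m k n} {A A′ : Matrix m k} (B : Matrix k n) → A ≋ A′ → A ⊠ B ≋ A′ ⊠ B
  ⊠-congʳ B e = ⊠-cong {B = B} e (λ _ _ → refl)

  ⊠-identityˡ : ∀ {m n} (A : Matrix m n) → 𝟙 ⊠ A ≋ A
  ⊠-identityˡ A i j = sum-𝟙ˡ (λ l → A l j) i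

  ⊠-identityʳ : ∀ {m n} (A : Matrix m n) → A ⊠ 𝟙 ≋ A
  ⊠-identityʳ A i j = sum-𝟙ʳ (A i) j

  ⊠-assoc : ∀ {m k l n} (A : Matrix m k) (B : Matrix k l) (C : Matrix l n) → (A ⊠ B) ⊠ C ≋ A ⊠ (B ⊠ C)
  ⊠-assoc {m} {k} {l} {n} A B C i j = begin
    ∑[ p < l ] (∑[ q < k ] (A i q * B q p) * C p j)
      ≈⟨ sum-cong-≋ {l} (λ p → trans (*-distribʳ-sum (C p j) (λ q → A i q * B q p)) (sum-cong-≋ {k} λ q → *-assoc _ _ _)) ⟩
    ∑[ p < l ] ∑[ q < k ] (A i q * (B q p * C p j))  ≈⟨ ∑-comm (λ p q → A i q * (B q p * C p j)) ⟩
    ∑[ q < k ] ∑[ p < l ] (A i q * (B q p * C p j))  ≈⟨ sum-cong-≋ {k} (λ q → *-distribˡ-sum (A i q) (λ p → B q p * C p j)) ⟨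
    ∑[ q < k ] (A i q * ∑[ p < l ] (B q p * C p j))  ∎

  ⊠-distribˡ-⊞ : ∀ {m k n} (A : Matrix m k) (B C : Matrix k n) → A ⊠ (B ⊞ C) ≋ (A ⊠ B) ⊞ (A ⊠ C)
  ⊠-distribˡ-⊞ {k = k} A B C i j = trans (sum-cong-≋ {k} λ l → distribˡ _ _ _) (∑-distrib-+ (λ l → A i l * B l j) (λ l → A i l * C l j))

  ⊠-distribʳ-⊞ : ∀ {m k n} (A B : Matrix m k) (C : Matrix k n) → (A ⊞ B) ⊠ C ≋ (A ⊠ C) ⊞ (B ⊠ C)
  ⊠-distribʳ-⊞ {k = k} A B C i j = trans (sum-cong-≋ {k} λ l → distribʳ _ _ _) (∑-distrib-+ (λ l → A i l * C l j) (λ l → B i l * C l j))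

  ·-⊠ˡ : ∀ {m k n} x (A : Matrix m k) (B : Matrix k n) → (x · A) ⊠ B ≋ x · (A ⊠ B)
  ·-⊠ˡ {k = k} x A B i j = trans (sum-cong-≋ {k} λ l → *-assoc _ _ _) (sym (*-distribˡ-sum x (λ l → A i l * B l j)))

  ·-⊠ʳ : ∀ {m k n} x (A : Matrix m k) (B : Matrix k n) → A ⊠ (x · B) ≋ x · (A ⊠ B)
  ·-⊠ʳ {k = k} x A B i j = trans (sum-cong-≋ {k} λ l → x∙yz≈y∙xz _ _ _) (sym (*-distribˡ-sum x (λ l → A i l * B l j)))

  -- A multivector on R^k is given by its coordinates on the products of basis
  -- vectors e_{i₁} ∧ … ∧ e_{iᵣ}, i₁ < … < iᵣ, indexed by characteristic vectors.
  Λ : ℕ → Set c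
  Λ k = Vec Bool k → Carrier

  infix 4 _≈Λ_
  _≈Λ_ : ∀ {k} → Λ k → Λ k → Set ℓ
  x ≈Λ y = ∀ s → x s ≈ y s

  infixl 6 _+Λ_
  _+Λ_ : ∀ {k} → Λ k → Λ k → Λ k
  (x +Λ y) s = x s + y s

  infixl 7 _*Λ_
  _*Λ_ : ∀ {k} → Carrier → Λ k → Λ k
  (a *Λ x) s = a * x s

  -- Left exterior multiplication. With v = v₀ e₀ + v′ and x = x₀ + e₀ ∧ x₁, where v′, x₀, x₁ do not
  -- involve e₀, one has v ∧ x = v′ ∧ x₀ + e₀ ∧ (v₀ x₀ - v′ ∧ x₁).
  wedge : ∀ {k} → Vector k → Λ k → Λ k
  wedge v x []          = 0#
  wedge v x (false ∷ s) = wedge (v ∘ suc) (x ∘ (false ∷_)) s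
  wedge v x (true ∷ s)  = v zero * x (false ∷ s) - wedge (v ∘ suc) (x ∘ (true ∷_)) s

  wedges : ∀ {n k} → Matrix n k → Λ k → Λ k
  wedges {zero}  A x = x
  wedges {suc n} A x = wedge (A zero) (wedges (A ∘ suc) x)

  wedge-cong : ∀ {k} {u v : Vector k} {x y : Λ k} → (∀ i → u i ≈ v i) → x ≈Λ y → wedge u x ≈Λ wedge v y
  wedge-cong e f []          = refl
  wedge-cong e f (false ∷ s) = wedge-cong (e ∘ suc) (f ∘ (false ∷_)) s
  wedge-cong e f (true ∷ s)  =
    +-cong (*-cong (e zero) (f (false ∷ s))) (-‿cong (wedge-cong (e ∘ suc) (f ∘ (true ∷_)) s))

  wedge-congʳ : ∀ {k} (v : Vector k) {x y : Λ k} → x ≈Λ y → wedge v x ≈Λ wedge v y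
  wedge-congʳ v = wedge-cong (λ i → refl)

  wedge-+ˡ : ∀ {k} (u v : Vector k) (x : Λ k) → wedge (λ i → u i + v i) x ≈Λ wedge u x +Λ wedge v x
  wedge-+ˡ u v x []          = sym (+-identityˡ 0#)
  wedge-+ˡ u v x (false ∷ s) = wedge-+ˡ (u ∘ suc) (v ∘ suc) _ s
  wedge-+ˡ u v x (true ∷ s)  = begin
    (u zero + v zero) * x₀ - wedge (λ i → u (suc i) + v (suc i)) x₁ s
      ≈⟨ +-cong (distribʳ _ _ _) (trans (-‿cong (wedge-+ˡ (u ∘ suc) (v ∘ suc) x₁ s)) (sym (-‿+-comm _ _))) ⟩
    (u zero * x₀ + v zero * x₀) + (- wedge (u ∘ suc) x₁ s + - wedge (v ∘ suc) x₁ s)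
      ≈⟨ interchange _ _ _ _ ⟩
    (u zero * x₀ - wedge (u ∘ suc) x₁ s) + (v zero * x₀ - wedge (v ∘ suc) x₁ s) ∎
    where
    x₀ = x (false ∷ s)
    x₁ = x ∘ (true ∷_)

  wedge-+ʳ : ∀ {k} (v : Vector k) (x y : Λ k) → wedge v (x +Λ y) ≈Λ wedge v x +Λ wedge v y
  wedge-+ʳ v x y []          = sym (+-identityˡ 0#)
  wedge-+ʳ v x y (false ∷ s) = wedge-+ʳ (v ∘ suc) _ _ s
  wedge-+ʳ v x y (true ∷ s)  = begin
    v zero * (x (false ∷ s) + y (false ∷ s)) - wedge (v ∘ suc) (x₁ +Λ y₁) s
      ≈⟨ +-cong (distribˡ _ _ _) (trans (-‿cong (wedge-+ʳ (v ∘ suc) x₁ y₁ s)) (sym (-‿+-comm _ _))) ⟩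
    (v zero * x (false ∷ s) + v zero * y (false ∷ s)) + (- wedge (v ∘ suc) x₁ s + - wedge (v ∘ suc) y₁ s)
      ≈⟨ interchange _ _ _ _ ⟩
    (v zero * x (false ∷ s) - wedge (v ∘ suc) x₁ s) + (v zero * y (false ∷ s) - wedge (v ∘ suc) y₁ s) ∎
    where
    x₁ = x ∘ (true ∷_)
    y₁ = y ∘ (true ∷_)

  distribˡ-- : ∀ a x y → a * (x - y) ≈ a * x - a * y
  distribˡ-- a x y = trans (distribˡ a x (- y)) (+-congˡ (sym (-‿distribʳ-* a y)))

  wedge-*ˡ : ∀ {k} a (v : Vector k) (x : Λ k) → wedge (λ i → a * v i) x ≈Λ a *Λ wedge v x
  wedge-*ˡ a v x []          = sym (zeroʳ a)
  wedge-*ˡ a v x (false ∷ s) = wedge-*ˡ a (v ∘ suc) _ s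
  wedge-*ˡ a v x (true ∷ s)  =
    trans (+-cong (*-assoc _ _ _) (-‿cong (wedge-*ˡ a (v ∘ suc) _ s))) (sym (distribˡ-- _ _ _))

  wedge-*ʳ : ∀ {k} a (v : Vector k) (x : Λ k) → wedge v (a *Λ x) ≈Λ a *Λ wedge v x
  wedge-*ʳ a v x []          = sym (zeroʳ a)
  wedge-*ʳ a v x (false ∷ s) = wedge-*ʳ a (v ∘ suc) _ s
  wedge-*ʳ a v x (true ∷ s)  =
    trans (+-cong (x∙yz≈y∙xz _ _ _) (-‿cong (wedge-*ʳ a (v ∘ suc) _ s))) (sym (distribˡ-- _ _ _))

  wedge-zeroʳ : ∀ {k} (v : Vector k) {x : Λ k} → (∀ s → x s ≈ 0#) → ∀ s → wedge v x s ≈ 0#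
  wedge-zeroʳ v {x} e s = begin
    wedge v x s              ≈⟨ wedge-congʳ v (λ s → trans (e s) (sym (zeroˡ _))) s ⟩
    wedge v (0# *Λ x) s      ≈⟨ wedge-*ʳ 0# v x s ⟩
    0# * wedge v x s         ≈⟨ zeroˡ _ ⟩
    0#                       ∎

  wedge-zeroˡ : ∀ {k} {v : Vector k} (x : Λ k) → (∀ i → v i ≈ 0#) → ∀ s → wedge v x s ≈ 0#
  wedge-zeroˡ {v = v} x e s = begin
    wedge v x s                   ≈⟨ wedge-cong (λ i → trans (e i) (sym (zeroˡ _))) (λ s → refl) s ⟩
    wedge (λ i → 0# * v i) x s    ≈⟨ wedge-*ˡ 0# v x s ⟩
    0# * wedge v x s              ≈⟨ zeroˡ _ ⟩
    0#                            ∎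

  wedge-negʳ : ∀ {k} (v : Vector k) (x : Λ k) s → wedge v (λ s → - x s) s ≈ - wedge v x s
  wedge-negʳ v x s = begin
    wedge v (λ s → - x s) s         ≈⟨ wedge-congʳ v (λ s → sym (-1*x≈-x _)) s ⟩
    wedge v (- 1# *Λ x) s           ≈⟨ wedge-*ʳ (- 1#) v x s ⟩
    - 1# * wedge v x s              ≈⟨ -1*x≈-x _ ⟩
    - wedge v x s                   ∎

  wedge-alternateʳ : ∀ j {k} (v : Vector k) (x : Λ k) s →
    wedge v (λ s → alternate j (x s)) s ≈ alternate j (wedge v x s)
  wedge-alternateʳ zero    v x s = refl
  wedge-alternateʳ (suc j) v x s = trans (wedge-negʳ v _ s) (-‿cong (wedge-alternateʳ j v x s))

  wedge-sumˡ : ∀ {k} n (a : Vector n) (b : Matrix n k) (x : Λ k) s →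
    wedge (λ i → ∑[ j < n ] (a j * b j i)) x s ≈ ∑[ j < n ] (a j * wedge (b j) x s)
  wedge-sumˡ zero    a b x s = wedge-zeroˡ x (λ i → refl) s
  wedge-sumˡ (suc n) a b x s = trans (wedge-+ˡ _ _ x s)
    (+-cong (wedge-*ˡ (a zero) (b zero) x s) (wedge-sumˡ n (a ∘ suc) (b ∘ suc) x s))

  -- In the coordinates containing e₀ the two copies of v₀ (v′ ∧ x₀) cancel, and v′ ∧ v′ ∧ x₁
  -- vanishes by induction. Deducing this from anticommutativity would require division by 2, so it
  -- comes first.
  wedge-self : ∀ {k} (v : Vector k) (x : Λ k) s → wedge v (wedge v x) s ≈ 0#
  wedge-self v x []          = refl
  wedge-self v x (false ∷ s) = wedge-self (v ∘ suc) _ s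
  wedge-self v x (true ∷ s)  = begin
    v₀x₀ - wedge v′ (λ s → v zero * x₀ s - wedge v′ x₁ s) s
      ≈⟨ +-congˡ (-‿cong (trans (wedge-+ʳ v′ _ _ s)
           (+-cong (wedge-*ʳ (v zero) v′ x₀ s) (trans (wedge-negʳ v′ _ s) (-‿cong (wedge-self v′ x₁ s)))))) ⟩
    v₀x₀ - (v₀x₀ - 0#)
      ≈⟨ +-congˡ (-‿cong (trans (+-congˡ -0#≈0#) (+-identityʳ _))) ⟩
    v₀x₀ - v₀x₀
      ≈⟨ -‿inverseʳ _ ⟩
    0# ∎
    where
    v′ = v ∘ suc
    x₀ = x ∘ (false ∷_)
    x₁ = x ∘ (true ∷_)
    v₀x₀ = v zero * wedge v′ x₀ s

  -- Polarisation of (u + v) ∧ (u + v) ∧ x = 0.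
  wedge-anticomm : ∀ {k} (u v : Vector k) (x : Λ k) s → wedge u (wedge v x) s ≈ - wedge v (wedge u x) s
  wedge-anticomm u v x s = +-inverseˡ-unique _ _ (begin
    wedge u (wedge v x) s + wedge v (wedge u x) s
      ≈⟨ +-cong (+-identityˡ _) (+-identityʳ _) ⟨
    (0# + wedge u (wedge v x) s) + (wedge v (wedge u x) s + 0#)
      ≈⟨ +-cong (+-congʳ (wedge-self u x s)) (+-congˡ (wedge-self v x s)) ⟨
    (wedge u (wedge u x) s + wedge u (wedge v x) s) + (wedge v (wedge u x) s + wedge v (wedge v x) s)
      ≈⟨ +-cong (wedge-+ʳ u _ _ s) (wedge-+ʳ v _ _ s) ⟨
    wedge u (wedge u x +Λ wedge v x) s + wedge v (wedge u x +Λ wedge v x) s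
      ≈⟨ wedge-+ˡ u v _ s ⟨
    wedge (λ i → u i + v i) (wedge u x +Λ wedge v x) s
      ≈⟨ wedge-congʳ _ (wedge-+ˡ u v x) s ⟨
    wedge (λ i → u i + v i) (wedge (λ i → u i + v i) x) s
      ≈⟨ wedge-self _ x s ⟩
    0# ∎)

  wedges-cong : ∀ {n k} {A B : Matrix n k} {x y : Λ k} → A ≋ B → x ≈Λ y → wedges A x ≈Λ wedges B y
  wedges-cong {zero}  e f = f
  wedges-cong {suc n} e f = wedge-cong (e zero) (wedges-cong (e ∘ suc) f)

  wedges-congʳ : ∀ {n k} (A : Matrix n k) {x y : Λ k} → x ≈Λ y → wedges A x ≈Λ wedges A y
  wedges-congʳ A = wedges-cong {A = A} (λ i j → refl)

  wedges-*ʳ : ∀ {n k} a (A : Matrix n k) (x : Λ k) → wedges A (a *Λ x) ≈Λ a *Λ wedges A x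
  wedges-*ʳ {zero}  a A x s = refl
  wedges-*ʳ {suc n} a A x s = trans (wedge-congʳ _ (wedges-*ʳ a (A ∘ suc) x) s) (wedge-*ʳ a _ _ s)

  wedge-wedges-zero : ∀ {n k} (v : Vector k) (A : Matrix n k) (x : Λ k) →
    (∀ s → wedge v x s ≈ 0#) → ∀ s → wedge v (wedges A x) s ≈ 0#
  wedge-wedges-zero {zero}  v A x e = e
  wedge-wedges-zero {suc n} v A x e s = begin
    wedge v (wedge (A zero) (wedges (A ∘ suc) x)) s    ≈⟨ wedge-anticomm v (A zero) _ s ⟩
    - wedge (A zero) (wedge v (wedges (A ∘ suc) x)) s  ≈⟨ -‿cong (wedge-zeroʳ (A zero) (wedge-wedges-zero v (A ∘ suc) x e) s) ⟩
    - 0#                                               ≈⟨ -0#≈0# ⟩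
    0#                                                 ∎

  wedge-row : ∀ {n k} (A : Matrix n k) (x : Λ k) i s → wedge (A i) (wedges A x) s ≈ 0#
  wedge-row {suc n} A x zero    s = wedge-self (A zero) _ s
  wedge-row {suc n} A x (suc i) s = begin
    wedge (A (suc i)) (wedge (A zero) (wedges (A ∘ suc) x)) s    ≈⟨ wedge-anticomm (A (suc i)) (A zero) _ s ⟩
    - wedge (A zero) (wedge (A (suc i)) (wedges (A ∘ suc) x)) s  ≈⟨ -‿cong (wedge-zeroʳ (A zero) (wedge-row (A ∘ suc) x i) s) ⟩
    - 0#                                                         ≈⟨ -0#≈0# ⟩
    0#                                                           ∎

  wedge-span : ∀ {n k} (a : Vector n) (A : Matrix n k) (x : Λ k) s →
    wedge (λ i → ∑[ j < n ] (a j * A j i)) (wedges A x) s ≈ 0#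
  wedge-span {n} a A x s = begin
    wedge (λ i → ∑[ j < n ] (a j * A j i)) (wedges A x) s  ≈⟨ wedge-sumˡ n a A _ s ⟩
    ∑[ j < n ] (a j * wedge (A j) (wedges A x) s)          ≈⟨ sum-cong-≋ {n} (λ j → trans (*-congˡ (wedge-row A x j s)) (zeroʳ _)) ⟩
    ∑[ j < n ] 0#                                          ≈⟨ sum-replicate-zero n ⟩
    0#                                                     ∎

  -- One sign for each of the n rows that v passes. This brings a vector standing behind a block of
  -- rows to the front, where linearity applies.
  wedges-wedge : ∀ {n k} (A : Matrix n k) (v : Vector k) (x : Λ k) s →
    wedges A (wedge v x) s ≈ alternate n (wedge v (wedges A x) s)
  wedges-wedge {zero}  A v x s = refl
  wedges-wedge {suc n} A v x s = begin
    wedge (A zero) (wedges (A ∘ suc) (wedge v x)) s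
      ≈⟨ wedge-congʳ (A zero) (wedges-wedge (A ∘ suc) v x) s ⟩
    wedge (A zero) (λ s → alternate n (wedge v (wedges (A ∘ suc) x) s)) s
      ≈⟨ wedge-alternateʳ n (A zero) _ s ⟩
    alternate n (wedge (A zero) (wedge v (wedges (A ∘ suc) x)) s)
      ≈⟨ alternate-cong n (wedge-anticomm (A zero) v _ s) ⟩
    alternate n (- wedge v (wedge (A zero) (wedges (A ∘ suc) x)) s)
      ≈⟨ alternate-neg n _ ⟩
    - alternate n (wedge v (wedge (A zero) (wedges (A ∘ suc) x)) s) ∎
    where
    alternate-neg : ∀ j y → alternate j (- y) ≈ - alternate j y
    alternate-neg zero    y = refl
    alternate-neg (suc j) y = -‿cong (alternate-neg j y)

  -- Row elimination: each `D i` can be moved right until it meets x, which it annihilates.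
  wedges-absorbʳ : ∀ {n k} (A D : Matrix n k) (x : Λ k) →
    (∀ i s → wedge (D i) x s ≈ 0#) → wedges (A ⊞ D) x ≈Λ wedges A x
  wedges-absorbʳ {zero}  A D x e s = refl
  wedges-absorbʳ {suc n} A D x e s = begin
    wedge (λ j → A zero j + D zero j) (wedges ((A ⊞ D) ∘ suc) x) s
      ≈⟨ wedge-congʳ _ (wedges-absorbʳ (A ∘ suc) (D ∘ suc) x (e ∘ suc)) s ⟩
    wedge (λ j → A zero j + D zero j) (wedges (A ∘ suc) x) s
      ≈⟨ wedge-+ˡ (A zero) (D zero) _ s ⟩
    wedge (A zero) (wedges (A ∘ suc) x) s + wedge (D zero) (wedges (A ∘ suc) x) s
      ≈⟨ +-congˡ (wedge-wedges-zero (D zero) (A ∘ suc) x (e zero) s) ⟩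
    wedge (A zero) (wedges (A ∘ suc) x) s + 0#
      ≈⟨ +-identityʳ _ ⟩
    wedge (A zero) (wedges (A ∘ suc) x) s ∎

  -- The mirror elimination, against rows on the left. The hypothesis ranges over all y because the
  -- product standing behind B changes from one row to the next.
  wedges-absorbˡ : ∀ {m n k} (B : Matrix m k) (A D : Matrix n k) (x : Λ k) →
    (∀ i y s → wedge (D i) (wedges B y) s ≈ 0#) → wedges B (wedges (A ⊞ D) x) ≈Λ wedges B (wedges A x)
  wedges-absorbˡ {m} {zero}  B A D x e s = refl
  wedges-absorbˡ {m} {suc n} B A D x e s = begin
    wedges B (wedge (λ j → A zero j + D zero j) y) s
      ≈⟨ wedges-wedge B _ y s ⟩
    alternate m (wedge (λ j → A zero j + D zero j) (wedges B y) s)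
      ≈⟨ alternate-cong m (trans (wedge-+ˡ (A zero) (D zero) _ s) (trans (+-congˡ (e zero y s)) (+-identityʳ _))) ⟩
    alternate m (wedge (A zero) (wedges B y) s)
      ≈⟨ alternate-cong m (wedge-congʳ (A zero) (wedges-absorbˡ B (A ∘ suc) (D ∘ suc) x (e ∘ suc)) s) ⟩
    alternate m (wedge (A zero) (wedges B (wedges (A ∘ suc) x)) s)
      ≈⟨ wedges-wedge B (A zero) _ s ⟨
    wedges B (wedge (A zero) (wedges (A ∘ suc) x)) s ∎
    where
    y = wedges ((A ⊞ D) ∘ suc) x

  -- Moving row j to the front passes j rows; this is the origin of the signs in the expansion of
  -- `det`.
  wedge-punchIn : ∀ {n k} (A : Matrix (suc n) k) (x : Λ k) j s →
    wedge (A j) (wedges (A ∘ punchIn j) x) s ≈ alternate (toℕ j) (wedges A x s)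
  wedge-punchIn A x zero s = refl
  wedge-punchIn {suc n} A x (suc j) s = begin
    wedge (A (suc j)) (wedge (A zero) (wedges (A ∘ suc ∘ punchIn j) x)) s
      ≈⟨ wedge-anticomm (A (suc j)) (A zero) _ s ⟩
    - wedge (A zero) (wedge (A (suc j)) (wedges (A ∘ suc ∘ punchIn j) x)) s
      ≈⟨ -‿cong (wedge-congʳ (A zero) (wedge-punchIn (A ∘ suc) x j) s) ⟩
    - wedge (A zero) (λ s → alternate (toℕ j) (wedges (A ∘ suc) x s)) s
      ≈⟨ -‿cong (wedge-alternateʳ (toℕ j) (A zero) _ s) ⟩
    - alternate (toℕ j) (wedge (A zero) (wedges (A ∘ suc) x) s) ∎

  -- By linearity the first row of MB contributes M₀ⱼ Bⱼ for each j. With Bⱼ in front, multiples of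
  -- Bⱼ in the other rows vanish, which leaves the minor of M times B without row j. Induction
  -- applies, and returning Bⱼ to its place gives the sign of the cofactor.
  wedges-⊠ : ∀ {n k} (M : Matrix n n) (B : Matrix n k) (x : Λ k) → wedges (M ⊠ B) x ≈Λ det n M *Λ wedges B x
  wedges-⊠ {zero}      M B x s = sym (*-identityˡ _)
  wedges-⊠ {suc n} {k} M B x s = begin
    wedge ((M ⊠ B) zero) (wedges ((M ⊠ B) ∘ suc) x) s
      ≈⟨ wedge-sumˡ (suc n) (M zero) B _ s ⟩
    ∑[ j < suc n ] (M zero j * wedge (B j) (wedges ((M ⊠ B) ∘ suc) x) s)
      ≈⟨ sum-cong-≋ {suc n} term ⟩
    ∑[ j < suc n ] (alternate (toℕ j) (M zero j * det n (minor j)) * wedges B x s)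
      ≈⟨ *-distribʳ-sum (wedges B x s) (λ j → alternate (toℕ j) (M zero j * det n (minor j))) ⟨
    det (suc n) M * wedges B x s ∎
    where
    minor : Fin (suc n) → Matrix n n
    minor j r c = M (suc r) (punchIn j c)
    term : ∀ j → M zero j * wedge (B j) (wedges ((M ⊠ B) ∘ suc) x) s
               ≈ alternate (toℕ j) (M zero j * det n (minor j)) * wedges B x s
    term j = begin
      M zero j * wedge (B j) (wedges ((M ⊠ B) ∘ suc) x) s
        -- Each later row of MB is split into its multiple of `B j` and the rest; the step after
        -- this drops the multiple.
        ≈⟨ *-congˡ (wedge-congʳ (B j) (wedges-cong (λ i l →
             trans (sum-remove {i = j} (λ p → M (suc i) p * B p l)) (+-comm _ _)) (λ s → refl)) s) ⟩
      M zero j * wedge (B j) (wedges ((minor j ⊠ (B ∘ punchIn j)) ⊞ (λ i l → M (suc i) j * B j l)) x) s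
        ≈⟨ *-congˡ (wedges-absorbˡ {m = 1} (λ _ → B j) _ (λ i l → M (suc i) j * B j l) x
             (λ i y s → trans (wedge-*ˡ (M (suc i) j) (B j) _ s) (trans (*-congˡ (wedge-self (B j) y s)) (zeroʳ _))) s) ⟩
      M zero j * wedge (B j) (wedges (minor j ⊠ (B ∘ punchIn j)) x) s
        ≈⟨ *-congˡ (wedge-congʳ (B j) (wedges-⊠ (minor j) (B ∘ punchIn j) x) s) ⟩
      M zero j * wedge (B j) (det n (minor j) *Λ wedges (B ∘ punchIn j) x) s
        ≈⟨ *-congˡ (wedge-*ʳ (det n (minor j)) (B j) _ s) ⟩
      M zero j * (det n (minor j) * wedge (B j) (wedges (B ∘ punchIn j) x) s)
        ≈⟨ *-assoc _ _ _ ⟨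
      (M zero j * det n (minor j)) * wedge (B j) (wedges (B ∘ punchIn j) x) s
        ≈⟨ *-congˡ (wedge-punchIn B x j s) ⟩
      (M zero j * det n (minor j)) * alternate (toℕ j) (wedges B x s)
        ≈⟨ alternate-*ˡ (toℕ j) _ _ ⟩
      alternate (toℕ j) ((M zero j * det n (minor j)) * wedges B x s)
        ≈⟨ alternate-*ʳ (toℕ j) _ _ ⟨
      alternate (toℕ j) (M zero j * det n (minor j)) * wedges B x s ∎

  oneΛ : ∀ {k} → Λ k
  oneΛ []          = 1#
  oneΛ (true ∷ s)  = 0#
  oneΛ (false ∷ s) = oneΛ s

  -- The coefficient of the full product of basis vectors, which for n = k is the determinant.
  volume : ∀ {n k} → Matrix n k → Carrier
  volume {n} {k} A = wedges A oneΛ (replicate k true)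

  -- The first row supplies e₀ and no other row involves e₀, so the rest is the same computation in
  -- one dimension less.
  volume-𝟙 : ∀ n → volume (𝟙 {n}) ≈ 1#
  volume-𝟙 zero    = refl
  volume-𝟙 (suc n) = begin
    1# * wedges (𝟙 ∘ suc) oneΛ (false ∷ replicate n true) - wedge {n} (λ j → 0#) _ (replicate n true)
      ≈⟨ +-cong (*-identityˡ _) (trans (-‿cong (wedge-zeroˡ {n} _ (λ j → refl) (replicate n true))) -0#≈0#) ⟩
    wedges (𝟙 {suc n} ∘ suc) oneΛ (false ∷ replicate n true) + 0#
      ≈⟨ +-identityʳ _ ⟩
    wedges (𝟙 {suc n} ∘ suc) oneΛ (false ∷ replicate n true)
      ≈⟨ wedges-false {n} (𝟙 {suc n} ∘ suc) oneΛ (replicate n true) ⟩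
    wedges (𝟙 {n}) oneΛ (replicate n true)
      ≈⟨ volume-𝟙 n ⟩
    1# ∎
    where
    wedges-false : ∀ {m k} (A : Matrix m (suc k)) (x : Λ (suc k)) s →
      wedges A x (false ∷ s) ≈ wedges (λ i → A i ∘ suc) (x ∘ (false ∷_)) s
    wedges-false {zero}  A x s = refl
    wedges-false {suc m} A x s = wedge-congʳ (A zero ∘ suc) (wedges-false (A ∘ suc) x) s

  volume-⊠ : ∀ {n} (A B : Matrix n n) → volume (A ⊠ B) ≈ det n A * volume B
  volume-⊠ {n} A B = wedges-⊠ A B oneΛ (replicate n true)

  -- `wedges-⊠` applied to A times the identity. Since `volume` is a closed formula in the rows,
  -- multiplicativity of `det` follows at once.
  det-volume : ∀ {n} (A : Matrix n n) → det n A ≈ volume A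
  det-volume {n} A = begin
    det n A                ≈⟨ *-identityʳ _ ⟨
    det n A * 1#           ≈⟨ *-congˡ (volume-𝟙 n) ⟨
    det n A * volume (𝟙 {n})  ≈⟨ volume-⊠ A 𝟙 ⟨
    volume (A ⊠ 𝟙)         ≈⟨ wedges-cong (⊠-identityʳ A) (λ s → refl) (replicate n true) ⟩
    volume A               ∎

  det-⊠ : ∀ {n} (A B : Matrix n n) → det n (A ⊠ B) ≈ det n A * det n B
  det-⊠ A B = trans (det-volume (A ⊠ B)) (trans (volume-⊠ A B) (*-congˡ (sym (det-volume B))))

  det-𝟙 : ∀ n → det n 𝟙 ≈ 1#
  det-𝟙 n = trans (det-volume (𝟙 {n})) (volume-𝟙 n)

  -- With e, f the two halves of the standard basis of R^{m+n}, both sides compute the coefficient of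
  -- ⋀ᵢ (eᵢ + Qᵢ f) ∧ ⋀ⱼ (fⱼ - Pⱼ e), by eliminating one family of vectors modulo the other.
  det-𝟙⊞-comm : ∀ {m n} (P : Matrix n m) (Q : Matrix m n) →
    det n (𝟙 ⊞ (P ⊠ Q)) ≈ det m (𝟙 ⊞ (Q ⊠ P))
  det-𝟙⊞-comm {m} {n} P Q = begin
    det n PQ                                     ≈⟨ *-identityʳ _ ⟨
    det n PQ * 1#                                ≈⟨ *-congˡ volume-ef ⟨
    det n PQ * wedges e (wedges f oneΛ) ⊤        ≈⟨ viaPQ ⟨
    wedges r (wedges s oneΛ) ⊤                   ≈⟨ viaQP ⟩
    det m QP * wedges e (wedges f oneΛ) ⊤        ≈⟨ *-congˡ volume-ef ⟩
    det m QP * 1#                                ≈⟨ *-identityʳ _ ⟩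
    det m QP                                     ∎
    where
    ⊤ = replicate (m ℕ.+ n) true
    PQ = 𝟙 ⊞ (P ⊠ Q)
    QP = 𝟙 ⊞ (Q ⊠ P)
    e : Matrix m (m ℕ.+ n)
    e i = 𝟙 (i ↑ˡ n)
    f : Matrix n (m ℕ.+ n)
    f j = 𝟙 (m ↑ʳ j)
    -P : Matrix n m
    -P i j = - P i j
    r = e ⊞ (Q ⊠ f)
    s = f ⊞ (-P ⊠ e)
    volume-ef : wedges e (wedges f oneΛ) ⊤ ≈ 1#
    volume-ef = trans (sym (split m 𝟙 oneΛ ⊤)) (volume-𝟙 (m ℕ.+ n))
      where
      split : ∀ m {k} (A : Matrix (m ℕ.+ n) k) (x : Λ k) →
        wedges A x ≈Λ wedges (A ∘ (_↑ˡ n)) (wedges (A ∘ (m ↑ʳ_)) x)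
      split zero    A x s = refl
      split (suc m) A x s = wedge-congʳ (A zero) (split m (A ∘ suc) x) s
    neg-⊠ : ∀ {a b c} (A : Matrix a b) (B : Matrix b c) i j → ((λ i j → - A i j) ⊠ B) i j ≈ - (A ⊠ B) i j
    neg-⊠ {b = b} A B i j = trans (sum-cong-≋ {b} (λ l → trans (sym (-‿distribˡ-* _ _)) (sym (-1*x≈-x _))))
      (trans (sym (*-distribˡ-sum (- 1#) (λ l → A i l * B l j))) (-1*x≈-x _))
    -- Substituting e = r - Q f into s = f - P e leaves (I + PQ) f modulo the rows of r.
    s≋ : s ≋ (PQ ⊠ f) ⊞ (-P ⊠ r)
    s≋ i j = sym (begin
      (PQ ⊠ f) i j + (-P ⊠ r) i j
        ≈⟨ +-cong (trans (⊠-distribʳ-⊞ 𝟙 (P ⊠ Q) f i j) (+-cong (⊠-identityˡ f i j) (⊠-assoc P Q f i j)))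
                  (trans (⊠-distribˡ-⊞ -P e (Q ⊠ f) i j) (+-congˡ (neg-⊠ P (Q ⊠ f) i j))) ⟩
      (f i j + (P ⊠ (Q ⊠ f)) i j) + ((-P ⊠ e) i j - (P ⊠ (Q ⊠ f)) i j)
        ≈⟨ interchange _ _ _ _ ⟩
      (f i j + (-P ⊠ e) i j) + ((P ⊠ (Q ⊠ f)) i j - (P ⊠ (Q ⊠ f)) i j)
        ≈⟨ trans (+-congˡ (-‿inverseʳ _)) (+-identityʳ _) ⟩
      s i j ∎)
    -- Symmetrically, f = s + P e turns r = e + Q f into (I + QP) e modulo the rows of s.
    r≋ : r ≋ (QP ⊠ e) ⊞ (Q ⊠ s)
    r≋ i j = sym (begin
      (QP ⊠ e) i j + (Q ⊠ s) i j
        ≈⟨ +-cong (trans (⊠-distribʳ-⊞ 𝟙 (Q ⊠ P) e i j) (+-cong (⊠-identityˡ e i j) (⊠-assoc Q P e i j)))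
                  (⊠-distribˡ-⊞ Q f (-P ⊠ e) i j) ⟩
      (e i j + (Q ⊠ (P ⊠ e)) i j) + ((Q ⊠ f) i j + (Q ⊠ (-P ⊠ e)) i j)
        ≈⟨ interchange _ _ _ _ ⟩
      (e i j + (Q ⊠ f) i j) + ((Q ⊠ (P ⊠ e)) i j + (Q ⊠ (-P ⊠ e)) i j)
        ≈⟨ +-congˡ (⊠-distribˡ-⊞ Q (P ⊠ e) (-P ⊠ e) i j) ⟨
      (e i j + (Q ⊠ f) i j) + (Q ⊠ ((P ⊠ e) ⊞ (-P ⊠ e))) i j
        ≈⟨ +-congˡ (trans (sum-cong-≋ {n} (λ l → trans (*-congˡ (trans (+-congˡ (neg-⊠ P e l j)) (-‿inverseʳ _))) (zeroʳ _)))
             (sum-replicate-zero n)) ⟩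
      (e i j + (Q ⊠ f) i j) + 0#
        ≈⟨ +-identityʳ _ ⟩
      r i j ∎)
    viaPQ : wedges r (wedges s oneΛ) ⊤ ≈ det n PQ * wedges e (wedges f oneΛ) ⊤
    viaPQ = begin
      wedges r (wedges s oneΛ) ⊤
        ≈⟨ wedges-congʳ r (wedges-cong s≋ (λ _ → refl)) ⊤ ⟩
      wedges r (wedges ((PQ ⊠ f) ⊞ (-P ⊠ r)) oneΛ) ⊤
        ≈⟨ wedges-absorbˡ r (PQ ⊠ f) (-P ⊠ r) oneΛ (λ i y t → wedge-span (-P i) r y t) ⊤ ⟩
      wedges r (wedges (PQ ⊠ f) oneΛ) ⊤
        ≈⟨ wedges-congʳ r (wedges-⊠ PQ f oneΛ) ⊤ ⟩
      wedges r (det n PQ *Λ wedges f oneΛ) ⊤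
        ≈⟨ wedges-*ʳ (det n PQ) r _ ⊤ ⟩
      det n PQ * wedges r (wedges f oneΛ) ⊤
        ≈⟨ *-congˡ (wedges-absorbʳ e (Q ⊠ f) (wedges f oneΛ) (λ i t → wedge-span (Q i) f oneΛ t) ⊤) ⟩
      det n PQ * wedges e (wedges f oneΛ) ⊤ ∎
    viaQP : wedges r (wedges s oneΛ) ⊤ ≈ det m QP * wedges e (wedges f oneΛ) ⊤
    viaQP = begin
      wedges r (wedges s oneΛ) ⊤
        ≈⟨ wedges-cong r≋ (λ _ → refl) ⊤ ⟩
      wedges ((QP ⊠ e) ⊞ (Q ⊠ s)) (wedges s oneΛ) ⊤
        ≈⟨ wedges-absorbʳ (QP ⊠ e) (Q ⊠ s) (wedges s oneΛ) (λ i t → wedge-span (Q i) s oneΛ t) ⊤ ⟩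
      wedges (QP ⊠ e) (wedges s oneΛ) ⊤
        ≈⟨ wedges-⊠ QP e _ ⊤ ⟩
      det m QP * wedges e (wedges s oneΛ) ⊤
        ≈⟨ *-congˡ (wedges-absorbˡ e f (-P ⊠ e) oneΛ (λ i y t → wedge-span (-P i) e y t) ⊤) ⟩
      det m QP * wedges e (wedges f oneΛ) ⊤ ∎

  -- Rank-one and low-rank perturbations of a determinant

  cofactor : ∀ {n k} → Vector n → Matrix n k → Λ k → Λ k
  cofactor {zero}  a A x s = 0#
  cofactor {suc n} a A x s = a zero * wedges (A ∘ suc) x s - wedge (A zero) (cofactor (a ∘ suc) (A ∘ suc) x) s

  -- `cofactor a A x` is the sum over i of (-1)ⁱ aᵢ times the wedge of x with all rows but Aᵢ, so
  -- wedging it with v puts aᵢ v in place of row i. Terms with v in two rows vanish, which makes the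
  -- expansion exact after first order.
  wedges-rankOne : ∀ {n k} (a : Vector n) (v : Vector k) (A : Matrix n k) (x : Λ k) →
    wedges (λ i j → A i j + a i * v j) x ≈Λ wedges A x +Λ wedge v (cofactor a A x)
  wedges-rankOne {zero}  a v A x s = sym (trans (+-congˡ (wedge-zeroʳ v (λ _ → refl) s)) (+-identityʳ _))
  wedges-rankOne {suc n} a v A x s = begin
    wedge (λ j → A zero j + a zero * v j) (wedges (λ i j → A (suc i) j + a (suc i) * v j) x) s
      ≈⟨ wedge-congʳ _ (wedges-rankOne (a ∘ suc) v (A ∘ suc) x) s ⟩
    wedge (λ j → A zero j + a zero * v j) (W +Λ wedge v C) s
      ≈⟨ wedge-+ˡ (A zero) (λ j → a zero * v j) _ s ⟩
    wedge (A zero) (W +Λ wedge v C) s + wedge (λ j → a zero * v j) (W +Λ wedge v C) s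
      ≈⟨ +-cong (wedge-+ʳ (A zero) W _ s) (trans (wedge-*ˡ (a zero) v _ s) (*-congˡ (wedge-+ʳ v W _ s))) ⟩
    (wedge (A zero) W s + wedge (A zero) (wedge v C) s) + a zero * (wedge v W s + wedge v (wedge v C) s)
      ≈⟨ +-cong (+-congˡ (wedge-anticomm (A zero) v C s)) (*-congˡ (trans (+-congˡ (wedge-self v C s)) (+-identityʳ _))) ⟩
    (wedge (A zero) W s - wedge v (wedge (A zero) C) s) + a zero * wedge v W s
      ≈⟨ trans (+-assoc _ _ _) (+-congˡ (+-comm _ _)) ⟩
    wedge (A zero) W s + (a zero * wedge v W s - wedge v (wedge (A zero) C) s)
      ≈⟨ +-congˡ (+-cong (wedge-*ʳ (a zero) v W s) (wedge-negʳ v _ s)) ⟨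
    wedge (A zero) W s + (wedge v (a zero *Λ W) s + wedge v (λ s → - wedge (A zero) C s) s)
      ≈⟨ +-congˡ (wedge-+ʳ v _ _ s) ⟨
    wedge (A zero) W s + wedge v (cofactor a A x) s ∎
    where
    W = wedges (A ∘ suc) x
    C = cofactor (a ∘ suc) (A ∘ suc) x

  -- The value vᵀ adj(A) a of the matrix determinant lemma, obtained without inverting A and visibly
  -- linear in v. With a = `ones` it is the F of the overview.
  rankOneTerm : ∀ {n} → Matrix n n → Vector n → Vector n → Carrier
  rankOneTerm {n} A a v = wedge v (cofactor a A oneΛ) (replicate n true)

  det-rankOne : ∀ {n} (A : Matrix n n) (a v : Vector n) →
    det n (λ i j → A i j + a i * v j) ≈ det n A + rankOneTerm A a v
  det-rankOne {n} A a v = begin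
    det n (λ i j → A i j + a i * v j)     ≈⟨ det-volume (λ i j → A i j + a i * v j) ⟩
    volume (λ i j → A i j + a i * v j)    ≈⟨ wedges-rankOne a v A oneΛ (replicate n true) ⟩
    volume A + rankOneTerm A a v          ≈⟨ +-congʳ (det-volume A) ⟨
    det n A + rankOneTerm A a v           ∎

  rankOneTerm-+ : ∀ {n} (A : Matrix n n) (a u v : Vector n) →
    rankOneTerm A a (λ j → u j + v j) ≈ rankOneTerm A a u + rankOneTerm A a v
  rankOneTerm-+ {n} A a u v = wedge-+ˡ u v (cofactor a A oneΛ) (replicate n true)

  rankOneTerm-* : ∀ {n} (A : Matrix n n) (a : Vector n) x (v : Vector n) →
    rankOneTerm A a (λ j → x * v j) ≈ x * rankOneTerm A a v
  rankOneTerm-* {n} A a x v = wedge-*ˡ x v (cofactor a A oneΛ) (replicate n true)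

  columnSum : ∀ {m n} → Matrix m n → Vector n
  columnSum {m} A j = ∑[ i < m ] A i j

  -- As BG = I, the matrix B + PSE factors as B (I + GPSE); moving E to the front of the product
  -- then reduces the determinant from size n to size m.
  det-lowRankUpdate : ∀ {m n} (B G : Matrix n n) (P : Matrix n m) (S : Matrix m m) (E : Matrix m n) →
    B ⊠ G ≋ 𝟙 → det n (B ⊞ P ⊠ (S ⊠ E)) ≈ det n B * det m (𝟙 ⊞ (E ⊠ (G ⊠ P)) ⊠ S)
  det-lowRankUpdate {m} {n} B G P S E BG = begin
    det n (B ⊞ P ⊠ (S ⊠ E))
      ≈⟨ det-cong n factor ⟨
    det n (B ⊠ (𝟙 ⊞ (G ⊠ (P ⊠ S)) ⊠ E))
      ≈⟨ det-⊠ B _ ⟩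
    det n B * det n (𝟙 ⊞ (G ⊠ (P ⊠ S)) ⊠ E)
      ≈⟨ *-congˡ (det-𝟙⊞-comm (G ⊠ (P ⊠ S)) E) ⟩
    det n B * det m (𝟙 ⊞ E ⊠ (G ⊠ (P ⊠ S)))
      ≈⟨ *-congˡ (det-cong m λ i j → +-congˡ (regroup i j)) ⟩
    det n B * det m (𝟙 ⊞ (E ⊠ (G ⊠ P)) ⊠ S) ∎
    where
    factor : B ⊠ (𝟙 ⊞ (G ⊠ (P ⊠ S)) ⊠ E) ≋ B ⊞ P ⊠ (S ⊠ E)
    factor i j = begin
      (B ⊠ (𝟙 ⊞ (G ⊠ (P ⊠ S)) ⊠ E)) i j
        ≈⟨ ⊠-distribˡ-⊞ B 𝟙 ((G ⊠ (P ⊠ S)) ⊠ E) i j ⟩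
      (B ⊠ 𝟙) i j + (B ⊠ ((G ⊠ (P ⊠ S)) ⊠ E)) i j
        ≈⟨ +-cong (⊠-identityʳ B i j) (sym (⊠-assoc B (G ⊠ (P ⊠ S)) E i j)) ⟩
      B i j + ((B ⊠ (G ⊠ (P ⊠ S))) ⊠ E) i j
        ≈⟨ +-congˡ (⊠-congʳ E (λ k l → sym (⊠-assoc B G (P ⊠ S) k l)) i j) ⟩
      B i j + (((B ⊠ G) ⊠ (P ⊠ S)) ⊠ E) i j
        ≈⟨ +-congˡ (⊠-congʳ E (λ k l → trans (⊠-congʳ (P ⊠ S) BG k l) (⊠-identityˡ (P ⊠ S) k l)) i j) ⟩
      B i j + ((P ⊠ S) ⊠ E) i j
        ≈⟨ +-congˡ (⊠-assoc P S E i j) ⟩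
      B i j + (P ⊠ (S ⊠ E)) i j ∎
    regroup : E ⊠ (G ⊠ (P ⊠ S)) ≋ (E ⊠ (G ⊠ P)) ⊠ S
    regroup i j = begin
      (E ⊠ (G ⊠ (P ⊠ S))) i j   ≈⟨ ⊠-congˡ E (⊠-assoc G P S) i j ⟨
      (E ⊠ ((G ⊠ P) ⊠ S)) i j   ≈⟨ ⊠-assoc E (G ⊠ P) S i j ⟨
      ((E ⊠ (G ⊠ P)) ⊠ S) i j   ∎

  ones : ∀ {n} → Vector n
  ones i = 1#

  -- Here C = a I + b J, and every row of J S is the vector of column sums of S, so the b-part is a
  -- rank-one perturbation with constant column.
  det-constantOffDiagonal : ∀ {m} (C S : Matrix m m) (x a b : Carrier) → (∀ i j → C i j ≈ a * 𝟙 i j + b) →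
    det m (𝟙 ⊞ C ⊠ (x · S)) ≈ det m (λ i j → (𝟙 ⊞ (x * a) · S) i j + ones i * (x * b * columnSum S j))
  det-constantOffDiagonal {m} C S x a b e = det-cong m λ i j → begin
    𝟙 i j + (C ⊠ (x · S)) i j
      ≈⟨ +-congˡ (⊠-congʳ (x · S) e i j) ⟩
    𝟙 i j + (((a · 𝟙) ⊞ (λ _ _ → b)) ⊠ (x · S)) i j
      ≈⟨ +-congˡ (⊠-distribʳ-⊞ (a · 𝟙) (λ _ _ → b) (x · S) i j) ⟩
    𝟙 i j + (((a · 𝟙) ⊠ (x · S)) i j + ((λ _ _ → b) ⊠ (x · S)) i j)
      ≈⟨ +-assoc _ _ _ ⟨
    (𝟙 i j + ((a · 𝟙) ⊠ (x · S)) i j) + ((λ _ _ → b) ⊠ (x · S)) i j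
      ≈⟨ +-cong (+-congˡ (trans (·-⊠ˡ a 𝟙 (x · S) i j) (trans (*-congˡ (⊠-identityˡ (x · S) i j))
                  (trans (x∙yz≈y∙xz a x _) (sym (*-assoc x a _))))))
                (trans (sum-cong-≋ {m} (λ l → trans (x∙yz≈y∙xz b x _) (sym (*-assoc x b _))))
                  (trans (sym (*-distribˡ-sum (x * b) (λ l → S l j))) (sym (*-identityˡ _)))) ⟩
    (𝟙 i j + x * a * S i j) + 1# * (x * b * columnSum S j) ∎

  columnSum-𝟙 : ∀ {n} (j : Fin n) → columnSum 𝟙 j ≈ 1#
  columnSum-𝟙 {n} j = trans (sum-cong-≋ {n} λ i → sym (*-identityˡ _)) (sum-𝟙ʳ ones j)

  module _ {m} (α : Carrier) (S : Matrix m m) where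
    private
      N = 𝟙 ⊞ α · S
      F = rankOneTerm N ones

    -- Multiplying by I + J on the left adds to each row of N the column sums of N, namely 1 + α
    -- 1ᵀS: again a rank-one change. The factor det (I + J) depends on m alone and can stay
    -- unevaluated.
    rankOneTerm-relation : det m N + (F ones + α * F (columnSum S)) ≈ det m (𝟙 ⊞ (λ _ _ → 1#)) * det m N
    rankOneTerm-relation = begin
      det m N + (F ones + α * F (columnSum S))
        ≈⟨ +-congˡ (+-congˡ (rankOneTerm-* N ones α (columnSum S))) ⟨
      det m N + (F ones + F (λ j → α * columnSum S j))
        ≈⟨ +-congˡ (rankOneTerm-+ N ones ones (λ j → α * columnSum S j)) ⟨
      det m N + F (λ j → 1# + α * columnSum S j)
        ≈⟨ det-rankOne N ones (λ j → 1# + α * columnSum S j) ⟨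
      det m (λ i j → N i j + 1# * (1# + α * columnSum S j))
        ≈⟨ det-cong m (λ i j → sym (trans (⊠-distribʳ-⊞ 𝟙 (λ _ _ → 1#) N i j) (+-cong (⊠-identityˡ N i j) (trans
             (sym (*-distribˡ-sum 1# (λ l → N l j)))
             (*-congˡ (trans (∑-distrib-+ (λ l → 𝟙 l j) (λ l → α * S l j))
                (+-cong (columnSum-𝟙 j) (sym (*-distribˡ-sum α (λ l → S l j)))))))))) ⟩
      det m ((𝟙 ⊞ (λ _ _ → 1#)) ⊠ N)
        ≈⟨ det-⊠ (𝟙 ⊞ (λ _ _ → 1#)) N ⟩
      det m (𝟙 ⊞ (λ _ _ → 1#)) * det m N ∎

  -- The second determinant equality determines α F(1), because -α J is a rank-one perturbation;
  -- `rankOneTerm-relation` then leads to F of the column sums, and the determinant in question is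
  -- det N plus β times that value.
  det-columnSum-determined : ∀ {m} (α β : Carrier) (S₁ S₂ : Matrix m m) →
    (∀ x y → α * x ≈ α * y → x ≈ y) →
    det m (𝟙 ⊞ α · S₁) ≈ det m (𝟙 ⊞ α · S₂) →
    det m (λ i j → (𝟙 ⊞ α · S₁) i j - α) ≈ det m (λ i j → (𝟙 ⊞ α · S₂) i j - α) →
    det m (λ i j → (𝟙 ⊞ α · S₁) i j + ones i * (β * columnSum S₁ j)) ≈
    det m (λ i j → (𝟙 ⊞ α · S₂) i j + ones i * (β * columnSum S₂ j))
  det-columnSum-determined {m} α β S₁ S₂ cancel eqN eqJ = begin
    det m (λ i j → N₁ i j + 1# * (β * columnSum S₁ j))  ≈⟨ det-rankOne N₁ ones _ ⟩
    det m N₁ + F₁ (λ j → β * columnSum S₁ j)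
      ≈⟨ +-cong eqN (trans (rankOneTerm-* N₁ ones β (columnSum S₁)) (trans (*-congˡ F-columnSum) (sym (rankOneTerm-* N₂ ones β (columnSum S₂))))) ⟩
    det m N₂ + F₂ (λ j → β * columnSum S₂ j)            ≈⟨ det-rankOne N₂ ones _ ⟨
    det m (λ i j → N₂ i j + 1# * (β * columnSum S₂ j))  ∎
    where
    N₁ = 𝟙 ⊞ α · S₁
    N₂ = 𝟙 ⊞ α · S₂
    F₁ = rankOneTerm N₁ ones
    F₂ = rankOneTerm N₂ ones
    shiftJ : ∀ (S : Matrix m m) → det m (λ i j → (𝟙 ⊞ α · S) i j - α) ≈ det m (𝟙 ⊞ α · S) + - α * rankOneTerm (𝟙 ⊞ α · S) ones ones
    shiftJ S = begin
      det m (λ i j → (𝟙 ⊞ α · S) i j - α)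
        ≈⟨ det-cong m (λ i j → +-congˡ (trans (*-identityˡ _) (*-identityʳ _))) ⟨
      det m (λ i j → (𝟙 ⊞ α · S) i j + 1# * (- α * 1#))
        ≈⟨ det-rankOne (𝟙 ⊞ α · S) ones _ ⟩
      det m (𝟙 ⊞ α · S) + rankOneTerm (𝟙 ⊞ α · S) ones (λ j → - α * 1#)
        ≈⟨ +-congˡ (rankOneTerm-* (𝟙 ⊞ α · S) ones (- α) ones) ⟩
      det m (𝟙 ⊞ α · S) + - α * rankOneTerm (𝟙 ⊞ α · S) ones ones ∎
    F-ones : α * F₁ ones ≈ α * F₂ ones
    F-ones = -‿injective (begin
      - (α * F₁ ones)  ≈⟨ -‿distribˡ-* _ _ ⟩
      - α * F₁ ones    ≈⟨ +-cancelˡ (det m N₂) _ _ (trans (+-congʳ (sym eqN)) (trans (sym (shiftJ S₁)) (trans eqJ (shiftJ S₂)))) ⟩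
      - α * F₂ ones    ≈⟨ -‿distribˡ-* _ _ ⟨
      - (α * F₂ ones)  ∎)
    F-sum : F₁ ones + α * F₁ (columnSum S₁) ≈ F₂ ones + α * F₂ (columnSum S₂)
    F-sum = +-cancelˡ (det m N₂) _ _ (trans (+-congʳ (sym eqN))
      (trans (rankOneTerm-relation α S₁) (trans (*-congˡ eqN) (sym (rankOneTerm-relation α S₂)))))
    -- Only α F(1) is known, so the relation is multiplied by α before subtracting it; hence α has
    -- to be cancelled twice.
    F-columnSum : F₁ (columnSum S₁) ≈ F₂ (columnSum S₂)
    F-columnSum = cancel _ _ (cancel _ _ (+-cancelˡ (α * F₂ ones) _ _ (begin
      α * F₂ ones + α * (α * F₁ (columnSum S₁))  ≈⟨ +-congʳ F-ones ⟨
      α * F₁ ones + α * (α * F₁ (columnSum S₁))  ≈⟨ distribˡ _ _ _ ⟨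
      α * (F₁ ones + α * F₁ (columnSum S₁))      ≈⟨ *-congˡ F-sum ⟩
      α * (F₂ ones + α * F₂ (columnSum S₂))      ≈⟨ distribˡ _ _ _ ⟩
      α * F₂ ones + α * (α * F₂ (columnSum S₂))  ∎)))

-- Formal power series

module PowerSeries where
  open import Data.Integer using (_+_; _*_; -_)

  Series : Set
  Series = ℕ → ℤ

  infix 4 _≗_
  _≗_ : Series → Series → Set
  f ≗ g = ∀ n → f n ≡ g n

  const : ℤ → Series
  const z zero    = z
  const z (suc n) = 0ℤ

  infixl 6 _⊕_
  _⊕_ : Series → Series → Series
  (f ⊕ g) n = f n + g n

  ⊖_ : Series → Series
  (⊖ f) n = - f n

  infixl 7 _⋆_
  -- The Cauchy product in the recursive form f g = f₀ g + t f′ g, where f = f₀ + t f′; it avoids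
  -- sums over pairs of indices.
  _⋆_ : Series → Series → Series
  (f ⋆ g) zero    = f 0 * g 0
  (f ⋆ g) (suc n) = f 0 * g (suc n) + ((f ∘ suc) ⋆ g) n

  ⋆-cong : ∀ {f f′ g g′} → f ≗ f′ → g ≗ g′ → f ⋆ g ≗ f′ ⋆ g′
  ⋆-cong e e′ zero    = cong₂ _*_ (e 0) (e′ 0)
  ⋆-cong e e′ (suc n) = cong₂ _+_ (cong₂ _*_ (e 0) (e′ (suc n))) (⋆-cong (e ∘ suc) e′ n)

  -- The product unfolded from its second factor. Comparing this with the defining recursion gives
  -- commutativity.
  ⋆-suc : ∀ f g n → (f ⋆ g) (suc n) ≡ (f ⋆ (g ∘ suc)) n + f (suc n) * g 0
  ⋆-suc f g zero    = ≡.refl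
  ⋆-suc f g (suc n) = ≡.trans (cong ((f 0 * g (suc (suc n))) +_) (⋆-suc (f ∘ suc) g n))
    (≡.sym (ℤ.+-assoc (f 0 * g (suc (suc n))) (((f ∘ suc) ⋆ (g ∘ suc)) n) (f (suc (suc n)) * g 0)))

  ⋆-comm : ∀ f g → f ⋆ g ≗ g ⋆ f
  ⋆-comm f g zero    = ℤ.*-comm (f 0) (g 0)
  ⋆-comm f g (suc n) = begin
    f 0 * g (suc n) + ((f ∘ suc) ⋆ g) n  ≡⟨ cong₂ _+_ (ℤ.*-comm (f 0) _) (⋆-comm (f ∘ suc) g n) ⟩
    g (suc n) * f 0 + (g ⋆ (f ∘ suc)) n  ≡⟨ ℤ.+-comm (g (suc n) * f 0) _ ⟩
    (g ⋆ (f ∘ suc)) n + g (suc n) * f 0  ≡⟨ ⋆-suc g f n ⟨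
    (g ⋆ f) (suc n)                      ∎
    where open ≡-Reasoning

  ⋆-distribʳ-⊕ : ∀ h f g → (f ⊕ g) ⋆ h ≗ f ⋆ h ⊕ g ⋆ h
  ⋆-distribʳ-⊕ h f g zero    = ℤ.*-distribʳ-+ (h 0) (f 0) (g 0)
  ⋆-distribʳ-⊕ h f g (suc n) = ≡.trans
    (cong (((f 0 + g 0) * h (suc n)) +_) (⋆-distribʳ-⊕ h (f ∘ suc) (g ∘ suc) n))
    (rearrange (f 0) (g 0) (h (suc n)) _ _)
    where
    rearrange : ∀ a b c d e → (a + b) * c + (d + e) ≡ (a * c + d) + (b * c + e)
    rearrange = solve-∀

  ⋆-scaleˡ : ∀ z f g → (λ n → z * f n) ⋆ g ≗ (λ n → z * (f ⋆ g) n)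
  ⋆-scaleˡ z f g zero    = ℤ.*-assoc z (f 0) (g 0)
  ⋆-scaleˡ z f g (suc n) = ≡.trans
    (cong₂ _+_ (ℤ.*-assoc z (f 0) (g (suc n))) (⋆-scaleˡ z (f ∘ suc) g n))
    (≡.sym (ℤ.*-distribˡ-+ z _ _))

  ⋆-assoc : ∀ f g h → (f ⋆ g) ⋆ h ≗ f ⋆ (g ⋆ h)
  ⋆-assoc f g h zero    = ℤ.*-assoc (f 0) (g 0) (h 0)
  ⋆-assoc f g h (suc n) = begin
    f 0 * g 0 * h (suc n) + (((λ m → f 0 * g (suc m)) ⊕ (f ∘ suc) ⋆ g) ⋆ h) n
      ≡⟨ cong ((f 0 * g 0 * h (suc n)) +_) (⋆-distribʳ-⊕ h _ ((f ∘ suc) ⋆ g) n) ⟩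
    f 0 * g 0 * h (suc n) + (((λ m → f 0 * g (suc m)) ⋆ h) n + (((f ∘ suc) ⋆ g) ⋆ h) n)
      ≡⟨ cong₂ (λ x y → f 0 * g 0 * h (suc n) + (x + y)) (⋆-scaleˡ (f 0) (g ∘ suc) h n) (⋆-assoc (f ∘ suc) g h n) ⟩
    f 0 * g 0 * h (suc n) + (f 0 * ((g ∘ suc) ⋆ h) n + ((f ∘ suc) ⋆ (g ⋆ h)) n)
      ≡⟨ rearrange (f 0) (g 0) (h (suc n)) _ _ ⟩
    f 0 * (g 0 * h (suc n) + ((g ∘ suc) ⋆ h) n) + ((f ∘ suc) ⋆ (g ⋆ h)) n ∎
    where
    open ≡-Reasoning
    rearrange : ∀ a b c d e → a * b * c + (a * d + e) ≡ a * (b * c + d) + e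
    rearrange = solve-∀

  const-⋆ : ∀ z f n → (const z ⋆ f) n ≡ z * f n
  const-⋆ z f zero    = ≡.refl
  const-⋆ z f (suc n) = ≡.trans (cong ((z * f (suc n)) +_) (zero-⋆ f n)) (ℤ.+-identityʳ (z * f (suc n)))
    where
    zero-⋆ : ∀ f n → ((λ _ → 0ℤ) ⋆ f) n ≡ 0ℤ
    zero-⋆ f zero    = ≡.refl
    zero-⋆ f (suc n) = ≡.trans (ℤ.+-identityˡ _) (zero-⋆ f n)

  ⋆-identityˡ : ∀ f → const 1ℤ ⋆ f ≗ f
  ⋆-identityˡ f n = ≡.trans (const-⋆ 1ℤ f n) (ℤ.*-identityˡ (f n))

  seriesRing : CommutativeRing 0ℓ 0ℓ
  seriesRing = record
    { Carrier = Series
    ; _≈_ = _≗_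
    ; _+_ = _⊕_
    ; _*_ = _⋆_
    ; -_ = ⊖_
    ; 0# = λ _ → 0ℤ
    ; 1# = const 1ℤ
    ; isCommutativeRing = record
      { isRing = record
        { +-isAbelianGroup = record
          { isGroup = record
            { isMonoid = record
              { isSemigroup = record
                { isMagma = record
                  { isEquivalence = record
                    { refl = λ n → ≡.refl ; sym = λ e n → ≡.sym (e n) ; trans = λ e e′ n → ≡.trans (e n) (e′ n) }
                  ; ∙-cong = λ e e′ n → cong₂ _+_ (e n) (e′ n) }
                ; assoc = λ f g h n → ℤ.+-assoc (f n) (g n) (h n) }
              ; identity = (λ f n → ℤ.+-identityˡ (f n)) , (λ f n → ℤ.+-identityʳ (f n)) }
            ; inverse = (λ f n → ℤ.+-inverseˡ (f n)) , (λ f n → ℤ.+-inverseʳ (f n))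
            ; ⁻¹-cong = λ e n → cong -_ (e n) }
          ; comm = λ f g n → ℤ.+-comm (f n) (g n) }
        ; *-cong = ⋆-cong
        ; *-assoc = ⋆-assoc
        ; *-identity = ⋆-identityˡ , λ f n → ≡.trans (⋆-comm f (const 1ℤ) n) (⋆-identityˡ f n)
        ; distrib = (λ f g h n → ≡.trans (⋆-comm f (g ⊕ h) n) (≡.trans (⋆-distribʳ-⊕ f g h n)
            (cong₂ _+_ (⋆-comm g f n) (⋆-comm h f n)))) , ⋆-distribʳ-⊕
        }
      ; *-comm = ⋆-comm
      }
    }

  t : Series
  t zero    = 0ℤ
  t (suc n) = const 1ℤ n

  t⋆-suc : ∀ f n → (t ⋆ f) (suc n) ≡ f n
  t⋆-suc f n = ≡.trans (ℤ.+-identityˡ _) (⋆-identityˡ f n)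

  -- The constant term of h g is h₀, so h₀ = 0; the tail of h is then annihilated by g as well.
  ⋆-cancel-zero : ∀ g h → g 0 ≡ 1ℤ → (∀ n → (h ⋆ g) n ≡ 0ℤ) → ∀ n → h n ≡ 0ℤ
  ⋆-cancel-zero g h g₀ e zero    = ≡.trans (≡.sym (ℤ.*-identityʳ (h 0))) (≡.trans (cong (h 0 *_) (≡.sym g₀)) (e 0))
  ⋆-cancel-zero g h g₀ e (suc n) = ⋆-cancel-zero g (h ∘ suc) g₀ e′ n
    where
    e′ : ∀ n → ((h ∘ suc) ⋆ g) n ≡ 0ℤ
    e′ n = begin
      ((h ∘ suc) ⋆ g) n                      ≡⟨ ℤ.+-identityˡ _ ⟨
      0ℤ * g (suc n) + ((h ∘ suc) ⋆ g) n     ≡⟨ cong (λ x → x * g (suc n) + ((h ∘ suc) ⋆ g) n) (⋆-cancel-zero g h g₀ e 0) ⟨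
      (h ⋆ g) (suc n)                        ≡⟨ e (suc n) ⟩
      0ℤ                                     ∎
      where open ≡-Reasoning

  -- Multiplication by t is a shift and g has constant term 1, so t g is not a zero divisor. This is
  -- the cancellation property of α = t a.
  t⋆-cancel : ∀ g h k → g 0 ≡ 1ℤ → (t ⋆ g) ⋆ h ≗ (t ⋆ g) ⋆ k → h ≗ k
  t⋆-cancel g h k g₀ e n = ℤ.i-j≡0⇒i≡j (h n) (k n) (⋆-cancel-zero g (h ⊕ ⊖ k) g₀ vanishing n)
    where
    module S = CommutativeRing seriesRing
    vanishing : ∀ n → ((h ⊕ ⊖ k) ⋆ g) n ≡ 0ℤ
    vanishing n = begin
      ((h ⊕ ⊖ k) ⋆ g) n                   ≡⟨ ⋆-comm _ g n ⟩
      (g ⋆ (h ⊕ ⊖ k)) n                   ≡⟨ t⋆-suc (g ⋆ (h ⊕ ⊖ k)) n ⟨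
      (t ⋆ (g ⋆ (h ⊕ ⊖ k))) (suc n)       ≡⟨ ⋆-assoc t g _ (suc n) ⟨
      (t ⋆ g ⋆ (h ⊕ ⊖ k)) (suc n)         ≡⟨ S.distribˡ (t ⋆ g) h (⊖ k) (suc n) ⟩
      (t ⋆ g ⋆ h ⊕ t ⋆ g ⋆ ⊖ k) (suc n)   ≡⟨ cong₂ _+_ (e (suc n)) (≡.sym (-‿distribʳ-* (t ⋆ g) k (suc n))) ⟩
      (t ⋆ g ⋆ k ⊕ ⊖ (t ⋆ g ⋆ k)) (suc n) ≡⟨ ℤ.+-inverseʳ ((t ⋆ g ⋆ k) (suc n)) ⟩
      0ℤ                                  ∎
      where
      open ≡-Reasoning
      open import Algebra.Properties.Ring S.ring using (-‿distribʳ-*)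

  const-cong : ∀ {x y} → x ≡ y → const x ≗ const y
  const-cong e n = cong (λ z → const z n) e

  const-+ : ∀ x y → const (x + y) ≗ const x ⊕ const y
  const-+ x y zero    = ≡.refl
  const-+ x y (suc n) = ≡.refl

  const-neg : ∀ x → const (- x) ≗ ⊖ const x
  const-neg x zero    = ≡.refl
  const-neg x (suc n) = ≡.refl

  const-0 : const 0ℤ ≗ λ _ → 0ℤ
  const-0 zero    = ≡.refl
  const-0 (suc n) = ≡.refl

  const-* : ∀ x y → const (x * y) ≗ const x ⋆ const y
  const-* x y zero    = ≡.refl
  const-* x y (suc n) = ≡.sym (≡.trans (const-⋆ x (const y) (suc n)) (ℤ.*-zeroʳ x))

open PowerSeries

-- Characteristic polynomials

coeff-+P : ∀ p q i → coeff (p +P q) i ≡ coeff p i ℤ.+ coeff q i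
coeff-+P []      q       i       = ≡.sym (ℤ.+-identityˡ _)
coeff-+P (a ∷ p) []      i       = ≡.sym (ℤ.+-identityʳ _)
coeff-+P (a ∷ p) (b ∷ q) zero    = ≡.refl
coeff-+P (a ∷ p) (b ∷ q) (suc i) = coeff-+P p q i

coeff-scaleP : ∀ z p i → coeff (scaleP z p) i ≡ z ℤ.* coeff p i
coeff-scaleP z []      i       = ≡.sym (ℤ.*-zeroʳ z)
coeff-scaleP z (a ∷ p) zero    = ≡.refl
coeff-scaleP z (a ∷ p) (suc i) = coeff-scaleP z p i

-- p = a + b x, expressed through the action of p by multiplication.
record IsLinear (p : Poly) (a b : ℤ) : Set where
  field
    coeff-zero : ∀ q → coeff (p *P q) 0 ≡ a ℤ.* coeff q 0
    coeff-suc  : ∀ q i → coeff (p *P q) (suc i) ≡ a ℤ.* coeff q (suc i) ℤ.+ b ℤ.* coeff q i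
open IsLinear

coeff-0∷[] : ∀ i → coeff (0ℤ ∷ []) i ≡ 0ℤ
coeff-0∷[] zero    = ≡.refl
coeff-0∷[] (suc i) = ≡.refl

constP-isLinear : ∀ a → IsLinear (constP a) a 0ℤ
constP-isLinear a .coeff-zero q  = ≡.trans (coeff-+P (scaleP a q) _ 0)
  (≡.trans (ℤ.+-identityʳ _) (coeff-scaleP a q 0))
constP-isLinear a .coeff-suc q i = ≡.trans (coeff-+P (scaleP a q) _ (suc i))
  (cong (ℤ._+ 0ℤ) (coeff-scaleP a q (suc i)))

linear-isLinear : ∀ a b → IsLinear (a ∷ b ∷ []) a b
linear-isLinear a b .coeff-zero q  = ≡.trans (coeff-+P (scaleP a q) _ 0)
  (≡.trans (ℤ.+-identityʳ _) (coeff-scaleP a q 0))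
linear-isLinear a b .coeff-suc q i = ≡.trans (coeff-+P (scaleP a q) _ (suc i))
  (cong₂ ℤ._+_ (coeff-scaleP a q (suc i)) (≡.trans (coeff-+P (scaleP b q) _ i)
    (≡.trans (cong₂ ℤ._+_ (coeff-scaleP b q i) (coeff-0∷[] i)) (ℤ.+-identityʳ _))))

coeff-altP-zero : ∀ j p i → coeff p i ≡ 0ℤ → coeff (altP j p) i ≡ 0ℤ
coeff-altP-zero zero    p i e = e
coeff-altP-zero (suc j) p i e = ≡.trans (coeff-scaleP (ℤ.- 1ℤ) (altP j p) i)
  (cong (ℤ.- 1ℤ ℤ.*_) (coeff-altP-zero j p i e))

coeff-sumP-zero : ∀ {m} (p : Fin m → Poly) i → (∀ j → coeff (p j) i ≡ 0ℤ) → coeff (sumP p) i ≡ 0ℤ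
coeff-sumP-zero {zero}  p i e = ≡.refl
coeff-sumP-zero {suc m} p i e = ≡.trans (coeff-+P (p zero) _ i)
  (cong₂ ℤ._+_ (e zero) (coeff-sumP-zero (p ∘ suc) i (e ∘ suc)))

-- Each linear entry raises the degree by at most one. The bound concerns coefficients and not list
-- length, since coefficient lists may end in zeros.
det-degree : ∀ n (E : Fin n → Fin n → Poly) (a b : Fin n → Fin n → ℤ) →
  (∀ i j → IsLinear (E i j) (a i j) (b i j)) → ∀ {k} → n ℕ.< k → coeff (Defs.det n E) k ≡ 0ℤ
det-degree zero    E a b lin {suc k} n<k = ≡.refl
det-degree (suc n) E a b lin {suc k} (s≤s n<k) = coeff-sumP-zero (λ j → altP (toℕ j) (E zero j *P minor j)) (suc k) λ j →
  coeff-altP-zero (toℕ j) (E zero j *P minor j) (suc k) (≡.trans (coeff-suc (lin zero j) (minor j) k)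
    (cong₂ ℤ._+_
      (≡.trans (cong (a zero j ℤ.*_) (minor-degree j (ℕ.m≤n⇒m≤1+n n<k))) (ℤ.*-zeroʳ (a zero j)))
      (≡.trans (cong (b zero j ℤ.*_) (minor-degree j n<k)) (ℤ.*-zeroʳ (b zero j)))))
  where
  minor : Fin (suc n) → Poly
  minor j = Defs.det n (λ r c → E (suc r) (punchIn j c))
  minor-degree : ∀ j {k} → n ℕ.< k → coeff (minor j) k ≡ 0ℤ
  minor-degree j = det-degree n _ _ _ (λ r c → lin (suc r) (punchIn j c))

δ : ∀ {n} → Fin n → Fin n → ℤ
δ i j = if i == j then 1ℤ else 0ℤ

charPoly-isLinear : ∀ {n} (M : Fin n → Fin n → ℤ) i j →
  IsLinear (if i == j then varP +P constP (ℤ.- M i j) else constP (ℤ.- M i j)) (ℤ.- M i j) (δ i j)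
charPoly-isLinear M i j with i == j
... | true  = ≡.subst (λ z → IsLinear (0ℤ ℤ.+ (ℤ.- M i j) ∷ 1ℤ ∷ []) z 1ℤ) (ℤ.+-identityˡ _) (linear-isLinear _ 1ℤ)
... | false = constP-isLinear _

charPoly-degree : ∀ n M {k} → n ℕ.< k → coeff (charPoly n M) k ≡ 0ℤ
charPoly-degree n M = det-degree n _ _ δ (charPoly-isLinear M)

-- Evaluating characteristic polynomials in a ring

module Pencil {c ℓ} (R : CommutativeRing c ℓ) (⟦_⟧ : ℤ → CommutativeRing.Carrier R)
  (isHom : IsRingHomomorphism ℤ.+-*-rawRing (CommutativeRing.rawRing R) ⟦_⟧) where
  open CommutativeRing R hiding (zero)
  open IsRingHomomorphism isHom using (⟦⟧-cong; +-homo; *-homo; 0#-homo; 1#-homo; -‿homo)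
  open LinearAlgebra R
  open import Algebra.Properties.Ring ring
  open import Algebra.Properties.Semiring.Sum semiring
  open import Algebra.Properties.Semiring.Exp semiring using (_^_)
  open import Algebra.Properties.CommutativeSemigroup +-commutativeSemigroup using (interchange)
  open import Algebra.Properties.CommutativeSemigroup *-commutativeSemigroup using (x∙yz≈y∙xz)
  open import Relation.Binary.Reasoning.Setoid setoid

  module _ (u v : Carrier) where

    -- The homogenisation Σ_{i ≤ n} fᵢ uⁱ vⁿ⁻ⁱ of a coefficient sequence f.
    homEval : ℕ → (ℕ → ℤ) → Carrier
    homEval zero    f = ⟦ f 0 ⟧
    homEval (suc n) f = ⟦ f 0 ⟧ * v ^ suc n + u * homEval n (f ∘ suc)

    homEval-cong : ∀ n {f g : ℕ → ℤ} → (∀ i → f i ≡ g i) → homEval n f ≈ homEval n g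
    homEval-cong zero    e = ⟦⟧-cong (e 0)
    homEval-cong (suc n) e = +-cong (*-congʳ (⟦⟧-cong (e 0))) (*-congˡ (homEval-cong n (e ∘ suc)))

    homEval-+ : ∀ n f g → homEval n (λ i → f i ℤ.+ g i) ≈ homEval n f + homEval n g
    homEval-+ zero    f g = +-homo (f 0) (g 0)
    homEval-+ (suc n) f g = begin
      ⟦ f 0 ℤ.+ g 0 ⟧ * v ^ suc n + u * homEval n (λ i → f (suc i) ℤ.+ g (suc i))
        ≈⟨ +-cong (trans (*-congʳ (+-homo (f 0) (g 0))) (distribʳ _ (⟦ f 0 ⟧) (⟦ g 0 ⟧)))
                  (trans (*-congˡ (homEval-+ n (f ∘ suc) (g ∘ suc))) (distribˡ u (homEval n (f ∘ suc)) (homEval n (g ∘ suc)))) ⟩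
      (⟦ f 0 ⟧ * v ^ suc n + ⟦ g 0 ⟧ * v ^ suc n) + (u * homEval n (f ∘ suc) + u * homEval n (g ∘ suc))
        ≈⟨ interchange (⟦ f 0 ⟧ * v ^ suc n) (⟦ g 0 ⟧ * v ^ suc n) _ _ ⟩
      homEval (suc n) f + homEval (suc n) g ∎

    homEval-scale : ∀ n z f → homEval n (λ i → z ℤ.* f i) ≈ ⟦ z ⟧ * homEval n f
    homEval-scale zero    z f = *-homo z (f 0)
    homEval-scale (suc n) z f = begin
      ⟦ z ℤ.* f 0 ⟧ * v ^ suc n + u * homEval n (λ i → z ℤ.* f (suc i))
        ≈⟨ +-cong (trans (*-congʳ (*-homo z (f 0))) (*-assoc (⟦ z ⟧) (⟦ f 0 ⟧) _))
                  (trans (*-congˡ (homEval-scale n z (f ∘ suc))) (x∙yz≈y∙xz u (⟦ z ⟧) _)) ⟩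
      ⟦ z ⟧ * (⟦ f 0 ⟧ * v ^ suc n) + ⟦ z ⟧ * (u * homEval n (f ∘ suc))
        ≈⟨ distribˡ (⟦ z ⟧) _ _ ⟨
      ⟦ z ⟧ * homEval (suc n) f ∎

    -- Homogenising to one degree more than the polynomial needs multiplies every term by v.
    homEval-raise : ∀ n f → f (suc n) ≡ 0ℤ → homEval (suc n) f ≈ v * homEval n f
    homEval-raise zero f e = begin
      ⟦ f 0 ⟧ * (v * 1#) + u * ⟦ f 1 ⟧
        ≈⟨ +-cong (trans (*-congˡ (*-identityʳ v)) (*-comm (⟦ f 0 ⟧) v))
                  (trans (*-congˡ (trans (⟦⟧-cong e) 0#-homo)) (zeroʳ u)) ⟩
      v * ⟦ f 0 ⟧ + 0#
        ≈⟨ +-identityʳ _ ⟩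
      v * ⟦ f 0 ⟧ ∎
    homEval-raise (suc n) f e = begin
      ⟦ f 0 ⟧ * (v * v ^ suc n) + u * homEval (suc n) (f ∘ suc)
        ≈⟨ +-cong (x∙yz≈y∙xz (⟦ f 0 ⟧) v (v ^ suc n))
                  (trans (*-congˡ (homEval-raise n (f ∘ suc) e)) (x∙yz≈y∙xz u v _)) ⟩
      v * (⟦ f 0 ⟧ * v ^ suc n) + v * (u * homEval n (f ∘ suc))
        ≈⟨ distribˡ v _ _ ⟨
      v * homEval (suc n) f ∎

    -- Homogenisation is multiplicative once degrees are matched: a + b x becomes a v + b u, and the
    -- vanishing coefficient ensures that q fits in degree n.
    homEval-linear-* : ∀ n p a b q → IsLinear p a b → coeff q (suc n) ≡ 0ℤ →
      homEval (suc n) (coeff (p *P q)) ≈ (⟦ a ⟧ * v + ⟦ b ⟧ * u) * homEval n (coeff q)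
    homEval-linear-* n p a b q lin deg = begin
      homEval (suc n) (coeff (p *P q))
        ≈⟨ homEval-cong (suc n) coeffs ⟩
      homEval (suc n) (λ i → a ℤ.* coeff q i ℤ.+ shifted i)
        ≈⟨ homEval-+ (suc n) (λ i → a ℤ.* coeff q i) shifted ⟩
      homEval (suc n) (λ i → a ℤ.* coeff q i) + homEval (suc n) shifted
        ≈⟨ +-cong (homEval-scale (suc n) a (coeff q))
                  (+-cong (trans (*-congʳ 0#-homo) (zeroˡ (v ^ suc n))) (*-congˡ (homEval-scale n b (coeff q)))) ⟩
      ⟦ a ⟧ * homEval (suc n) (coeff q) + (0# + u * (⟦ b ⟧ * homEval n (coeff q)))
        ≈⟨ +-cong (trans (*-congˡ (homEval-raise n (coeff q) deg)) (sym (*-assoc (⟦ a ⟧) v _)))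
                  (trans (+-identityˡ _) (trans (x∙yz≈y∙xz u (⟦ b ⟧) _) (sym (*-assoc (⟦ b ⟧) u _)))) ⟩
      ⟦ a ⟧ * v * homEval n (coeff q) + ⟦ b ⟧ * u * homEval n (coeff q)
        ≈⟨ distribʳ _ (⟦ a ⟧ * v) (⟦ b ⟧ * u) ⟨
      (⟦ a ⟧ * v + ⟦ b ⟧ * u) * homEval n (coeff q) ∎
      where
      shifted : ℕ → ℤ
      shifted zero    = 0ℤ
      shifted (suc i) = b ℤ.* coeff q i
      coeffs : ∀ i → coeff (p *P q) i ≡ a ℤ.* coeff q i ℤ.+ shifted i
      coeffs zero    = ≡.trans (coeff-zero lin q) (≡.sym (ℤ.+-identityʳ (a ℤ.* coeff q 0)))
      coeffs (suc i) = coeff-suc lin q i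

    homEval-altP : ∀ n j p → homEval n (coeff (altP j p)) ≈ alternate j (homEval n (coeff p))
    homEval-altP n zero    p = refl
    homEval-altP n (suc j) p = begin
      homEval n (coeff (negP (altP j p)))
        ≈⟨ homEval-cong n (coeff-scaleP (ℤ.- 1ℤ) (altP j p)) ⟩
      homEval n (λ i → ℤ.- 1ℤ ℤ.* coeff (altP j p) i)
        ≈⟨ homEval-scale n (ℤ.- 1ℤ) (coeff (altP j p)) ⟩
      ⟦ ℤ.- 1ℤ ⟧ * homEval n (coeff (altP j p))
        ≈⟨ trans (*-congʳ (trans (-‿homo 1ℤ) (-‿cong 1#-homo))) (-1*x≈-x (homEval n (coeff (altP j p)))) ⟩
      - homEval n (coeff (altP j p))
        ≈⟨ -‿cong (homEval-altP n j p) ⟩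
      - alternate j (homEval n (coeff p)) ∎

    homEval-0 : ∀ n → homEval n (λ _ → 0ℤ) ≈ 0#
    homEval-0 n = trans (homEval-scale n 0ℤ (λ _ → 0ℤ)) (trans (*-congʳ 0#-homo) (zeroˡ (homEval n (λ _ → 0ℤ))))

    homEval-sumP : ∀ n {m} (p : Fin m → Poly) → homEval n (coeff (sumP p)) ≈ ∑[ j < m ] homEval n (coeff (p j))
    homEval-sumP n {zero}  p = homEval-0 n
    homEval-sumP n {suc m} p = begin
      homEval n (coeff (p zero +P sumP (p ∘ suc)))
        ≈⟨ homEval-cong n (coeff-+P (p zero) (sumP (p ∘ suc))) ⟩
      homEval n (λ i → coeff (p zero) i ℤ.+ coeff (sumP (p ∘ suc)) i)
        ≈⟨ homEval-+ n (coeff (p zero)) (coeff (sumP (p ∘ suc))) ⟩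
      homEval n (coeff (p zero)) + homEval n (coeff (sumP (p ∘ suc)))
        ≈⟨ +-congˡ (homEval-sumP n (p ∘ suc)) ⟩
      homEval n (coeff (p zero)) + ∑[ j < m ] homEval n (coeff (p (suc j))) ∎

  -- Homogenisation respects the sums, signs and products of the expansion; `det-degree` supplies
  -- the degree bound for each minor.
  homEval-det : ∀ u v n (E : Fin n → Fin n → Poly) (a b : Fin n → Fin n → ℤ) →
    (∀ i j → IsLinear (E i j) (a i j) (b i j)) →
    homEval u v n (coeff (Defs.det n E)) ≈ det n (λ i j → ⟦ a i j ⟧ * v + ⟦ b i j ⟧ * u)
  homEval-det u v zero    E a b lin = 1#-homo
  homEval-det u v (suc n) E a b lin = trans (homEval-sumP u v (suc n) {suc n} (λ j → altP (toℕ j) (E zero j *P Defs.det n (minor j))))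
    (sum-cong-≋ {suc n} λ j → trans (homEval-altP u v (suc n) (toℕ j) (E zero j *P Defs.det n (minor j)))
      (alternate-cong (toℕ j) (trans
        (homEval-linear-* u v n (E zero j) (a zero j) (b zero j) (Defs.det n (minor j)) (lin zero j)
          (det-degree n (minor j) _ _ (λ r c → lin (suc r) (punchIn j c)) ℕ.≤-refl))
        (*-congˡ (homEval-det u v n (minor j) _ _ (λ r c → lin (suc r) (punchIn j c)))))))
    where
    minor : Fin (suc n) → Fin n → Fin n → Poly
    minor j r c = E (suc r) (punchIn j c)

  ⟦⟧-δ : ∀ {n} (i j : Fin n) → ⟦ δ i j ⟧ ≈ 𝟙 i j
  ⟦⟧-δ i j with i == j
  ... | true  = 1#-homo
  ... | false = 0#-homo

  -- Both coefficients are kept because several points (u, v) occur: (1, t) for X, (1, -α) for Y,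
  -- (κ, α) for its complement and (1, 0) for the leading coefficient. The homogeneous form avoids
  -- dividing by κ.
  pencil : ∀ {n} → Carrier → Carrier → Matrix n n → Matrix n n
  pencil u v K i j = u * 𝟙 i j - v * K i j

  pencil-inverse : ∀ {n} x (K G : Matrix n n) → (∀ i j → G i j ≈ 𝟙 i j + x * (K ⊠ G) i j) → pencil 1# x K ⊠ G ≋ 𝟙
  pencil-inverse x K G e i j = begin
    (pencil 1# x K ⊠ G) i j
      ≈⟨ ⊠-congʳ G (λ k l → +-cong (*-identityˡ (𝟙 k l)) (-‿distribˡ-* x (K k l))) i j ⟩
    ((𝟙 ⊞ (- x) · K) ⊠ G) i j
      ≈⟨ ⊠-distribʳ-⊞ 𝟙 ((- x) · K) G i j ⟩
    (𝟙 ⊠ G) i j + (((- x) · K) ⊠ G) i j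
      ≈⟨ +-cong (⊠-identityˡ G i j) (trans (·-⊠ˡ (- x) K G i j) (sym (-‿distribˡ-* x _))) ⟩
    G i j - x * (K ⊠ G) i j
      ≈⟨ +-congʳ (e i j) ⟩
    𝟙 i j + x * (K ⊠ G) i j - x * (K ⊠ G) i j
      ≈⟨ trans (+-assoc _ _ _) (trans (+-congˡ (-‿inverseʳ _)) (+-identityʳ _)) ⟩
    𝟙 i j ∎

  image : ∀ {n} → (Fin n → Fin n → ℤ) → Matrix n n
  image M i j = ⟦ M i j ⟧

  homEval-charPoly : ∀ u v n M → homEval u v n (coeff (charPoly n M)) ≈ det n (pencil u v (image M))
  homEval-charPoly u v n M = trans
    (homEval-det u v n (λ i j → if i == j then varP +P constP (ℤ.- M i j) else constP (ℤ.- M i j))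
      (λ i j → ℤ.- M i j) δ (charPoly-isLinear M))
    (det-cong n λ i j → begin
      ⟦ ℤ.- M i j ⟧ * v + ⟦ δ i j ⟧ * u
        ≈⟨ +-cong (trans (*-congʳ (-‿homo (M i j))) (trans (sym (-‿distribˡ-* ⟦ M i j ⟧ v)) (-‿cong (*-comm ⟦ M i j ⟧ v))))
                  (trans (*-congʳ (⟦⟧-δ i j)) (*-comm (𝟙 i j) u)) ⟩
      - (v * ⟦ M i j ⟧) + u * 𝟙 i j
        ≈⟨ +-comm _ (u * 𝟙 i j) ⟩
      pencil u v (image M) i j ∎)

  -- The form in which cospectrality is used: it transfers to every pair u, v of ring elements, in
  -- particular to power series.
  det-pencil-cong : ∀ u v n {M N} → charPoly n M ≈P charPoly n N →
    det n (pencil u v (image M)) ≈ det n (pencil u v (image N))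
  det-pencil-cong u v n {M} {N} e =
    trans (sym (homEval-charPoly u v n M)) (trans (homEval-cong u v n e) (homEval-charPoly u v n N))

const-isHom : IsRingHomomorphism ℤ.+-*-rawRing (CommutativeRing.rawRing seriesRing) const
const-isHom = record
  { isSemiringHomomorphism = record
    { isNearSemiringHomomorphism = record
      { +-isMonoidHomomorphism = record
        { isMagmaHomomorphism = record
          { isRelHomomorphism = record { cong = const-cong } ; homo = const-+ }
        ; ε-homo = const-0 }
      ; *-homo = const-* }
    ; 1#-homo = λ _ → ≡.refl }
  ; -‿homo = const-neg }

-- Size and coefficients recovered from determinants

module _ where
  open CommutativeRing seriesRing hiding (zero)
  open LinearAlgebra seriesRing
  open Pencil seriesRing const const-isHom
  open import Algebra.Properties.Ring ring
  open import Algebra.Properties.Semiring.Exp semiring using (_^_)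

  -- At (u, v) = (1, 0) the homogenisation retains only the leading coefficient, while u I - v M
  -- becomes I.
  charPoly-monic : ∀ n M → coeff (charPoly n M) n ≡ 1ℤ
  charPoly-monic n M = ≡.trans (≡.sym (at-1-0 n (coeff (charPoly n M)) 0)) (trans (homEval-charPoly 1# 0# n M)
    (trans (det-cong n λ i j → trans (+-cong (*-identityˡ (𝟙 i j)) (trans (-‿cong (zeroˡ (const (M i j)))) -0#≈0#))
      (+-identityʳ (𝟙 i j))) (det-𝟙 n)) 0)
    where
    at-1-0 : ∀ n f → homEval 1# 0# n f ≈ const (f n)
    at-1-0 zero    f = refl
    at-1-0 (suc n) f = trans (+-cong (trans (*-congˡ (zeroˡ (0# ^ n))) (zeroʳ (const (f 0))))
      (trans (*-identityˡ (homEval 1# 0# n (f ∘ suc))) (at-1-0 n (f ∘ suc)))) (+-identityˡ (const (f (suc n))))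

  charPoly-size : ∀ m n M N → charPoly m M ≈P charPoly n N → m ≡ n
  charPoly-size m n M N e with ℕ.<-cmp m n
  ... | tri≈ _ m≡n _ = m≡n
  ... | tri< m<n _ _ = contradiction (≡.trans (≡.sym (charPoly-monic n N)) (≡.trans (≡.sym (e n)) (charPoly-degree m M m<n))) λ ()
  ... | tri> _ _ n<m = contradiction (≡.trans (≡.sym (charPoly-monic m M)) (≡.trans (e m) (charPoly-degree n N n<m))) λ ()

  t^-self : ∀ n → (t ^ n) n ≡ 1ℤ
  t^-self zero    = ≡.refl
  t^-self (suc n) = ≡.trans (t⋆-suc (t ^ n) n) (t^-self n)

  t^-other : ∀ n k → k ≢ n → (t ^ n) k ≡ 0ℤ
  t^-other zero    zero    k≢n = contradiction ≡.refl k≢n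
  t^-other zero    (suc k) k≢n = ≡.refl
  t^-other (suc n) zero    k≢n = ≡.refl
  t^-other (suc n) (suc k) k≢n = ≡.trans (t⋆-suc (t ^ n) k) (t^-other n k (k≢n ∘ cong suc))

  homEval-1-t-suc : ∀ n f k → homEval 1# t (suc n) f k ≡ f 0 ℤ.* (t ^ suc n) k ℤ.+ homEval 1# t n (f ∘ suc) k
  homEval-1-t-suc n f k = cong₂ ℤ._+_ (const-⋆ (f 0) (t ^ suc n) k) (⋆-identityˡ (homEval 1# t n (f ∘ suc)) k)

  homEval-1-t-degree : ∀ n f k → n ℕ.< k → homEval 1# t n f k ≡ 0ℤ
  homEval-1-t-degree zero    f (suc k) n<k = ≡.refl
  homEval-1-t-degree (suc n) f k n<k = ≡.trans (homEval-1-t-suc n f k) (cong₂ ℤ._+_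
    (≡.trans (cong (f 0 ℤ.*_) (t^-other (suc n) k (ℕ.>⇒≢ n<k))) (ℤ.*-zeroʳ (f 0)))
    (homEval-1-t-degree n (f ∘ suc) k (ℕ.<-trans (ℕ.n<1+n n) n<k)))

  -- At (1, t) the homogenisation is the reversed polynomial Σ fᵢ tⁿ⁻ⁱ. Writing n as i + k makes k
  -- the exponent that belongs to fᵢ and permits induction on i without subtraction.
  homEval-1-t : ∀ i k f → homEval 1# t (i ℕ.+ k) f k ≡ f i
  homEval-1-t zero    zero    f = ≡.refl
  homEval-1-t zero    (suc k) f = ≡.trans (homEval-1-t-suc k f (suc k)) (≡.trans (cong₂ ℤ._+_
    (≡.trans (cong (f 0 ℤ.*_) (t^-self (suc k))) (ℤ.*-identityʳ (f 0)))
    (homEval-1-t-degree k (f ∘ suc) (suc k) ℕ.≤-refl)) (ℤ.+-identityʳ (f 0)))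
  homEval-1-t (suc i) k f = ≡.trans (homEval-1-t-suc (i ℕ.+ k) f k) (≡.trans (cong₂ ℤ._+_
    (≡.trans (cong (f 0 ℤ.*_) (t^-other (suc i ℕ.+ k) k (ℕ.<⇒≢ (s≤s (ℕ.m≤n+m k i))))) (ℤ.*-zeroʳ (f 0)))
    (homEval-1-t i k (f ∘ suc))) (ℤ.+-identityˡ _))

  charPoly-from-pencil : ∀ n M N → det n (pencil 1# t (image M)) ≈ det n (pencil 1# t (image N)) → charPoly n M ≈P charPoly n N
  charPoly-from-pencil n M N e i with i ℕ.≤? n
  ... | no i≰n = ≡.trans (charPoly-degree n M (ℕ.≰⇒> i≰n)) (≡.sym (charPoly-degree n N (ℕ.≰⇒> i≰n)))
  ... | yes i≤n with ℕ.m+[n∸m]≡n i≤n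
  ...   | i+k≡n = ≡.trans (≡.sym (recover M)) (≡.trans
            (trans (homEval-charPoly 1# t n M) (trans e (sym (homEval-charPoly 1# t n N))) (n ℕ.∸ i)) (recover N))
    where
    recover : ∀ K → homEval 1# t n (coeff (charPoly n K)) (n ℕ.∸ i) ≡ coeff (charPoly n K) i
    recover K = ≡.subst (λ m → homEval 1# t m (coeff (charPoly n K)) (n ℕ.∸ i) ≡ coeff (charPoly n K) i) i+k≡n
      (homEval-1-t i (n ℕ.∸ i) (coeff (charPoly n K)))

-- Graph matrices

==-≢ : ∀ {n} {u v : Fin n} → u ≢ v → (u == v) ≡ false
==-≢ {u = u} {v} u≢v = dec-false (u ≟ v) u≢v

==-injective : ∀ {m n} {ι : Fin m → Fin n} → Injective _≡_ _≡_ ι → ∀ a b → (ι a == ι b) ≡ (a == b)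
==-injective {ι = ι} inj a b with a ≟ b
... | yes ≡.refl = ==-refl (ι a)
... | no a≢b     = ==-≢ (a≢b ∘ inj)

anyFin-false : ∀ {n} (f : Fin n → Bool) → (∀ i → f i ≡ false) → anyFin f ≡ false
anyFin-false {zero}  f e = ≡.refl
anyFin-false {suc n} f e rewrite e zero = anyFin-false (f ∘ suc) (e ∘ suc)

anyFin-single : ∀ {n} (f : Fin n → Bool) i → (∀ j → j ≢ i → f j ≡ false) → anyFin f ≡ f i
anyFin-single {suc n} f zero e with f zero
... | true  = ≡.refl
... | false = anyFin-false (f ∘ suc) (λ j → e (suc j) λ ())
anyFin-single {suc n} f (suc i) e rewrite e zero (λ ()) =
  anyFin-single (f ∘ suc) i (λ j j≢i → e (suc j) (j≢i ∘ suc-injective))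

module _ {m n} (Y : Graph m) (ι : Fin m → Fin n) where

  hitEdge-outsideˡ : ∀ {u} v → (∀ a → ι a ≢ u) → hitEdge Y ι u v ≡ false
  hitEdge-outsideˡ {u} v u∉ι = anyFin-false _ λ a → anyFin-false _ λ b →
    ≡.trans (cong (λ e → adj Y a b ∧ (e ∧ (ι b == v))) (==-≢ (u∉ι a))) (∧-zeroʳ (adj Y a b))

  hitEdge-outsideʳ : ∀ u {v} → (∀ b → ι b ≢ v) → hitEdge Y ι u v ≡ false
  hitEdge-outsideʳ u {v} v∉ι = anyFin-false _ λ a → anyFin-false _ λ b →
    ≡.trans (cong (λ e → adj Y a b ∧ ((ι a == u) ∧ e)) (==-≢ (v∉ι b)))
      (≡.trans (cong (adj Y a b ∧_) (∧-zeroʳ (ι a == u))) (∧-zeroʳ (adj Y a b)))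

  -- By injectivity the double search can succeed only at the pair (a, b).
  hitEdge-inside : Injective _≡_ _≡_ ι → ∀ a b → hitEdge Y ι (ι a) (ι b) ≡ adj Y a b
  hitEdge-inside inj a b = begin
    hitEdge Y ι (ι a) (ι b)
      ≡⟨ anyFin-single _ a (λ a′ a′≢a → anyFin-false _ λ b′ →
           ≡.trans (cong (λ e → adj Y a′ b′ ∧ (e ∧ (ι b′ == ι b))) (==-≢ (a′≢a ∘ inj))) (∧-zeroʳ (adj Y a′ b′))) ⟩
    anyFin (λ b′ → adj Y a b′ ∧ ((ι a == ι a) ∧ (ι b′ == ι b)))
      ≡⟨ anyFin-single _ b (λ b′ b′≢b → ≡.trans (cong (λ e → adj Y a b′ ∧ ((ι a == ι a) ∧ e)) (==-≢ (b′≢b ∘ inj)))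
           (≡.trans (cong (adj Y a b′ ∧_) (∧-zeroʳ (ι a == ι a))) (∧-zeroʳ (adj Y a b′)))) ⟩
    adj Y a b ∧ ((ι a == ι a) ∧ (ι b == ι b))
      ≡⟨ cong₂ (λ e e′ → adj Y a b ∧ (e ∧ e′)) (==-refl (ι a)) (==-refl (ι b)) ⟩
    adj Y a b ∧ true
      ≡⟨ ∧-identityʳ (adj Y a b) ⟩
    adj Y a b ∎
    where open ≡-Reasoning

-- Laplacians over a ring and the effect of deleting edges

module GraphMatrices {c ℓ} (R : CommutativeRing c ℓ) (⟦_⟧ : ℤ → CommutativeRing.Carrier R)
  (isHom : IsRingHomomorphism ℤ.+-*-rawRing (CommutativeRing.rawRing R) ⟦_⟧) where
  open CommutativeRing R hiding (zero)
  open IsRingHomomorphism isHom using (⟦⟧-cong; +-homo; *-homo; 0#-homo; 1#-homo; -‿homo)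
  open LinearAlgebra R
  open Pencil R ⟦_⟧ isHom
  open import Algebra.Properties.Ring ring
  open import Algebra.Properties.Semiring.Sum semiring
  open import Relation.Binary.Reasoning.Setoid setoid

  ℤ⟶R : ℤ.+-*-rawRing -Raw-AlmostCommutative⟶ fromCommutativeRing R
  ℤ⟶R = record
    { ⟦_⟧ = ⟦_⟧ ; +-homo = +-homo ; *-homo = *-homo ; -‿homo = -‿homo ; 0-homo = 0#-homo ; 1-homo = 1#-homo }

  _image≟_ : ∀ x y → Maybe (⟦ x ⟧ ≈ ⟦ y ⟧)
  x image≟ y = Maybe.map ⟦⟧-cong (dec⇒maybe (x ℤ.≟ y))

  open RingSolver ℤ.+-*-rawRing (fromCommutativeRing R) ℤ⟶R _image≟_ using (solve; _:=_; _:+_; _:*_; _:-_; :-_; con)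

  indicator : Bool → Carrier
  indicator b = if b then 1# else 0#

  adjacency : ∀ {n} → Graph n → Matrix n n
  adjacency G i j = indicator (adj G i j)

  rowSum : ∀ {m n} → Matrix m n → Vector m
  rowSum {n = n} A i = ∑[ j < n ] A i j

  -- D + s A: the Laplacian for s = -1, the unsigned Laplacian for s = 1.
  weighted : ∀ {n} → Carrier → Graph n → Matrix n n
  weighted s G i j = 𝟙 i j * rowSum (adjacency G) i + s * adjacency G i j

  ⟦b2n⟧ : ∀ b → ⟦ ℤ.+ b2n b ⟧ ≈ indicator b
  ⟦b2n⟧ true  = 1#-homo
  ⟦b2n⟧ false = 0#-homo

  ⟦sumℕ⟧ : ∀ {n} (f : Fin n → ℕ) → ⟦ ℤ.+ sumℕ f ⟧ ≈ ∑[ i < n ] ⟦ ℤ.+ f i ⟧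
  ⟦sumℕ⟧ {zero}  f = 0#-homo
  ⟦sumℕ⟧ {suc n} f = trans (+-homo (ℤ.+ f zero) (ℤ.+ sumℕ (f ∘ suc))) (+-congˡ (⟦sumℕ⟧ (f ∘ suc)))

  ⟦degree⟧ : ∀ {n} (G : Graph n) u → ⟦ ℤ.+ degree G u ⟧ ≈ rowSum (adjacency G) u
  ⟦degree⟧ {n} G u = trans (⟦sumℕ⟧ (λ w → b2n (adj G u w))) (sum-cong-≋ {n} λ w → ⟦b2n⟧ (adj G u w))

  ⟦degℤ⟧ : ∀ {n} (G : Graph n) u v → ⟦ degℤ G u v ⟧ ≈ 𝟙 u v * rowSum (adjacency G) u
  ⟦degℤ⟧ G u v with u == v
  ... | true  = trans (⟦degree⟧ G u) (sym (*-identityˡ _))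
  ... | false = trans 0#-homo (sym (zeroˡ _))

  ⟦laplacian⟧ : ∀ {n} (G : Graph n) → image (laplacian G) ≋ weighted (- 1#) G
  ⟦laplacian⟧ G u v = trans (+-homo (degℤ G u v) (ℤ.- adjℤ G u v)) (+-cong (⟦degℤ⟧ G u v)
    (trans (-‿homo (adjℤ G u v)) (trans (-‿cong (⟦b2n⟧ (adj G u v))) (sym (-1*x≈-x _)))))

  ⟦signlessLaplacian⟧ : ∀ {n} (G : Graph n) → image (signlessLaplacian G) ≋ weighted 1# G
  ⟦signlessLaplacian⟧ G u v = trans (+-homo (degℤ G u v) (adjℤ G u v)) (+-cong (⟦degℤ⟧ G u v)
    (trans (⟦b2n⟧ (adj G u v)) (sym (*-identityˡ _))))

  adjacency-sym : ∀ {n} (G : Graph n) i j → adjacency G i j ≈ adjacency G j i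
  adjacency-sym G i j = reflexive (cong indicator (Graph.sym G i j))

  rowSum-𝟙 : ∀ {n} (i : Fin n) → rowSum 𝟙 i ≈ 1#
  rowSum-𝟙 {n} i = trans (sum-cong-≋ {n} λ j → sym (*-identityʳ _)) (sum-𝟙ˡ ones i)

  rowSum-⊠ : ∀ {m k n} (A : Matrix m k) (B : Matrix k n) i → rowSum (A ⊠ B) i ≈ ∑[ l < k ] (A i l * rowSum B l)
  rowSum-⊠ {k = k} A B i = trans (∑-comm (λ j l → A i l * B l j))
    (sum-cong-≋ {k} λ l → sym (*-distribˡ-sum (A i l) (B l)))

  -- Symmetry of the adjacency matrix turns its column sums into degrees.
  columnSum-laplacian : ∀ {n} (G : Graph n) j → columnSum (weighted (- 1#) G) j ≈ 0#
  columnSum-laplacian {n} G j = begin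
    ∑[ i < n ] (𝟙 i j * rowSum A i + - 1# * A i j)
      ≈⟨ ∑-distrib-+ (λ i → 𝟙 i j * rowSum A i) (λ i → - 1# * A i j) ⟩
    ∑[ i < n ] (𝟙 i j * rowSum A i) + ∑[ i < n ] (- 1# * A i j)
      ≈⟨ +-cong (trans (sum-cong-≋ {n} λ i → *-comm _ _) (sum-𝟙ʳ (rowSum A) j))
                (trans (sym (*-distribˡ-sum (- 1#) (λ i → A i j))) (trans (-1*x≈-x _) (-‿cong (sum-cong-≋ {n} λ i → adjacency-sym G i j)))) ⟩
    rowSum A j - rowSum A j
      ≈⟨ -‿inverseʳ _ ⟩
    0# ∎
    where
    A = adjacency G

  𝟙-≢ : ∀ {n} {i j : Fin n} → i ≢ j → 𝟙 i j ≈ 0#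
  𝟙-≢ i≢j = reflexive (cong (if_then 1# else 0#) (==-≢ i≢j))

  𝟙-merge : ∀ {n} (u w v : Fin n) → 𝟙 u w * 𝟙 w v ≈ 𝟙 u v * 𝟙 u w
  𝟙-merge u w v with u ≟ w
  ... | yes ≡.refl = *-comm _ _
  ... | no  _      = trans (zeroˡ _) (sym (zeroʳ _))

  module _ {m n} (ι : Fin m → Fin n) where

    inclusion : Matrix n m
    inclusion u a = 𝟙 u (ι a)

    restriction : Matrix m n
    restriction a u = 𝟙 (ι a) u

    extend : Matrix m m → Matrix n n
    extend S = inclusion ⊠ (S ⊠ restriction)

    restrict-⊠ : ∀ (G : Matrix n n) a b → (restriction ⊠ (G ⊠ inclusion)) a b ≈ G (ι a) (ι b)
    restrict-⊠ G a b = trans (⊠-congˡ restriction (λ u b → sum-𝟙ʳ (G u) (ι b)) a b)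
      (sum-𝟙ˡ (λ u → G u (ι b)) (ι a))

    extend-outsideˡ : ∀ S {u} v → (∀ a → ι a ≢ u) → extend S u v ≈ 0#
    extend-outsideˡ S v u∉ι = trans
      (sum-cong-≋ {m} λ a → trans (*-congʳ (𝟙-≢ (u∉ι a ∘ ≡.sym))) (zeroˡ _)) (sum-replicate-zero m)

    extend-outsideʳ : ∀ S u {v} → (∀ a → ι a ≢ v) → extend S u v ≈ 0#
    extend-outsideʳ S u v∉ι = trans
      (sum-cong-≋ {m} λ a → trans (*-congˡ (trans (sum-cong-≋ {m} λ b → trans (*-congˡ (𝟙-≢ (v∉ι b))) (zeroʳ _))
        (sum-replicate-zero m))) (zeroʳ _))
      (sum-replicate-zero m)

    extend-inside : Injective _≡_ _≡_ ι → ∀ S a b → extend S (ι a) (ι b) ≈ S a b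
    extend-inside inj S a b = begin
      ∑[ a′ < m ] (𝟙 (ι a) (ι a′) * ∑[ b′ < m ] (S a′ b′ * 𝟙 (ι b′) (ι b)))
        ≈⟨ sum-cong-≋ {m} (λ a′ → *-cong (𝟙-ι a a′) (trans (sum-cong-≋ {m} λ b′ → *-congˡ (𝟙-ι b′ b)) (sum-𝟙ʳ (S a′) b))) ⟩
      ∑[ a′ < m ] (𝟙 a a′ * S a′ b)
        ≈⟨ sum-𝟙ˡ (λ a′ → S a′ b) a ⟩
      S a b ∎
      where
      𝟙-ι : ∀ a b → 𝟙 (ι a) (ι b) ≈ 𝟙 a b
      𝟙-ι a b = reflexive (cong (if_then 1# else 0#) (==-injective inj a b))

    -- P diag(d) Pᵀ stays diagonal. For d the degrees of Y, the sum on the right is the degree that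
    -- u loses by the deletion, as `rowSum-extend` shows.
    extend-diagonal : ∀ (d : Vector m) u v →
      extend (λ a b → 𝟙 a b * d a) u v ≈ 𝟙 u v * ∑[ a < m ] (inclusion u a * d a)
    extend-diagonal d u v = begin
      ∑[ a < m ] (𝟙 u (ι a) * ∑[ b < m ] (𝟙 a b * d a * 𝟙 (ι b) v))
        ≈⟨ sum-cong-≋ {m} (λ a → trans (*-congˡ (trans (sum-cong-≋ {m} λ b → *-assoc _ _ _) (sum-𝟙ˡ (λ b → d a * 𝟙 (ι b) v) a)))
             (trans (*-congˡ (*-comm _ _)) (sym (*-assoc _ _ _)))) ⟩
      ∑[ a < m ] (𝟙 u (ι a) * 𝟙 (ι a) v * d a)
        ≈⟨ sum-cong-≋ {m} (λ a → trans (*-congʳ (𝟙-merge u (ι a) v)) (*-assoc _ _ _)) ⟩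
      ∑[ a < m ] (𝟙 u v * (𝟙 u (ι a) * d a))
        ≈⟨ *-distribˡ-sum (𝟙 u v) (λ a → 𝟙 u (ι a) * d a) ⟨
      𝟙 u v * ∑[ a < m ] (𝟙 u (ι a) * d a) ∎

    rowSum-extend : ∀ S u → rowSum (extend S) u ≈ ∑[ a < m ] (inclusion u a * rowSum S a)
    rowSum-extend S u = trans (rowSum-⊠ inclusion (S ⊠ restriction) u) (sum-cong-≋ {m} λ a → *-congˡ
      (trans (rowSum-⊠ S restriction a) (sum-cong-≋ {m} λ b → trans (*-congˡ (rowSum-𝟙 (ι b))) (*-identityʳ _))))

    extend-⊞ : ∀ S T → extend (S ⊞ T) ≋ extend S ⊞ extend T
    extend-⊞ S T u v = trans (⊠-congˡ inclusion (⊠-distribʳ-⊞ S T restriction) u v)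
      (⊠-distribˡ-⊞ inclusion (S ⊠ restriction) (T ⊠ restriction) u v)

    extend-· : ∀ x S → extend (x · S) ≋ x · extend S
    extend-· x S u v = trans (⊠-congˡ inclusion (·-⊠ˡ x S restriction) u v)
      (·-⊠ʳ x inclusion (S ⊠ restriction) u v)

  module _ {m n} (X : Graph n) (Y : Graph m) (ι : Fin m → Fin n) (clique : CliqueEmbedding X ι) where
    private
      inj = proj₁ clique

      keep : ∀ b {x} → x ≈ 0# → indicator (b ∧ true) ≈ indicator b - x
      keep b e = trans (reflexive (cong indicator (∧-identityʳ b)))
        (sym (trans (+-congˡ (trans (-‿cong e) -0#≈0#)) (+-identityʳ _)))

    -- Outside the image nothing changes. Inside it, the clique condition puts every edge of Y over
    -- an edge of X, so the Boolean deletion is a true subtraction and never yields 0 - 1.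
    adjacency-deleteEdges : ∀ u v → adjacency (deleteEdges X Y ι) u v ≈ adjacency X u v - extend ι (adjacency Y) u v
    adjacency-deleteEdges u v with any? (λ a → ι a ≟ u) | any? (λ b → ι b ≟ v)
    ... | no u∉ι | _ = trans
      (reflexive (cong (λ h → indicator (adj X u v ∧ not h)) (cong₂ _∨_
        (hitEdge-outsideˡ Y ι v (λ a e → u∉ι (a , e))) (hitEdge-outsideʳ Y ι v (λ a e → u∉ι (a , e))))))
      (keep (adj X u v) (extend-outsideˡ ι (adjacency Y) v (λ a e → u∉ι (a , e))))
    ... | yes _ | no v∉ι = trans
      (reflexive (cong (λ h → indicator (adj X u v ∧ not h)) (cong₂ _∨_
        (hitEdge-outsideʳ Y ι u (λ a e → v∉ι (a , e))) (hitEdge-outsideˡ Y ι u (λ a e → v∉ι (a , e))))))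
      (keep (adj X u v) (extend-outsideʳ ι (adjacency Y) u (λ a e → v∉ι (a , e))))
    ... | yes (a , ≡.refl) | yes (b , ≡.refl) = begin
      indicator (adj X (ι a) (ι b) ∧ not (hitEdge Y ι (ι a) (ι b) ∨ hitEdge Y ι (ι b) (ι a)))
        ≈⟨ reflexive (cong (λ h → indicator (adj X (ι a) (ι b) ∧ not h)) (≡.trans (cong₂ _∨_
             (hitEdge-inside Y ι inj a b) (≡.trans (hitEdge-inside Y ι inj b a) (Graph.sym Y b a))) (∨-idem (adj Y a b)))) ⟩
      indicator (adj X (ι a) (ι b) ∧ not (adj Y a b))
        ≈⟨ delete (adj X (ι a) (ι b)) (adj Y a b) edge ⟩
      indicator (adj X (ι a) (ι b)) - indicator (adj Y a b)
        ≈⟨ +-congˡ (-‿cong (extend-inside ι inj (adjacency Y) a b)) ⟨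
      adjacency X (ι a) (ι b) - extend ι (adjacency Y) (ι a) (ι b) ∎
      where
      edge : adj Y a b ≡ true → adj X (ι a) (ι b) ≡ true
      edge e = proj₂ clique a b λ a≡b → contradiction (≡.trans (≡.sym e) (≡.trans (cong (adj Y a) (≡.sym a≡b)) (irrefl Y a))) λ ()
      delete : ∀ x y → (y ≡ true → x ≡ true) → indicator (x ∧ not y) ≈ indicator x - indicator y
      delete x     false e = keep x refl
      delete true  true  e = sym (-‿inverseʳ 1#)
      delete false true  e = contradiction (e ≡.refl) λ ()

    rowSum-deleteEdges : ∀ u → rowSum (adjacency (deleteEdges X Y ι)) u ≈
      rowSum (adjacency X) u - ∑[ a < m ] (inclusion ι u a * rowSum (adjacency Y) a)
    rowSum-deleteEdges u = begin
      ∑[ v < n ] adjacency (deleteEdges X Y ι) u v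
        ≈⟨ sum-cong-≋ {n} (λ v → trans (adjacency-deleteEdges u v) (+-congˡ (sym (-1*x≈-x _)))) ⟩
      ∑[ v < n ] (adjacency X u v + - 1# * extend ι (adjacency Y) u v)
        ≈⟨ ∑-distrib-+ (adjacency X u) (λ v → - 1# * extend ι (adjacency Y) u v) ⟩
      rowSum (adjacency X) u + ∑[ v < n ] (- 1# * extend ι (adjacency Y) u v)
        ≈⟨ +-congˡ (trans (sym (*-distribˡ-sum (- 1#) (extend ι (adjacency Y) u))) (-1*x≈-x _)) ⟩
      rowSum (adjacency X) u - rowSum (extend ι (adjacency Y)) u
        ≈⟨ +-congˡ (-‿cong (rowSum-extend ι (adjacency Y) u)) ⟩
      rowSum (adjacency X) u - ∑[ a < m ] (inclusion ι u a * rowSum (adjacency Y) a) ∎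

    weighted-deleteEdges : ∀ s u v → weighted s (deleteEdges X Y ι) u v ≈ weighted s X u v - extend ι (weighted s Y) u v
    weighted-deleteEdges s u v = begin
      𝟙 u v * rowSum (adjacency (deleteEdges X Y ι)) u + s * adjacency (deleteEdges X Y ι) u v
        ≈⟨ +-cong (*-congˡ (rowSum-deleteEdges u)) (*-congˡ (adjacency-deleteEdges u v)) ⟩
      𝟙 u v * (rowSum (adjacency X) u - d) + s * (adjacency X u v - extend ι (adjacency Y) u v)
        ≈⟨ solve 6 (λ e x d s a y → e :* (x :- d) :+ s :* (a :- y) := (e :* x :+ s :* a) :- (e :* d :+ s :* y)) refl
             (𝟙 u v) (rowSum (adjacency X) u) d s (adjacency X u v) (extend ι (adjacency Y) u v) ⟩
      weighted s X u v - (𝟙 u v * d + s * extend ι (adjacency Y) u v)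
        ≈⟨ +-congˡ (-‿cong (trans (extend-⊞ ι (λ a b → 𝟙 a b * rowSum (adjacency Y) a) (s · adjacency Y) u v)
             (+-cong (extend-diagonal ι (rowSum (adjacency Y)) u v) (extend-· ι s (adjacency Y) u v)))) ⟨
      weighted s X u v - extend ι (weighted s Y) u v ∎
      where
      d = ∑[ a < m ] (inclusion ι u a * rowSum (adjacency Y) a)

  -- Aᶜ = J - I - A; absence of loops excludes the one combination of truth values for which this
  -- would fail.
  adjacency-complement : ∀ {n} (G : Graph n) i j → adjacency (complement G) i j ≈ 1# - 𝟙 i j - adjacency G i j
  adjacency-complement G i j = cases (adj G i j) (i == j) loopless
    where
    loopless : (i == j) ≡ true → adj G i j ≡ false
    loopless e with i ≟ j
    loopless e  | yes ≡.refl = irrefl G i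
    loopless () | no _
    cases : ∀ x e → (e ≡ true → x ≡ false) → indicator (not x ∧ not e) ≈ 1# - indicator e - indicator x
    cases true  true  h = contradiction (h ≡.refl) λ ()
    cases true  false h = sym (trans (+-congʳ (trans (+-congˡ -0#≈0#) (+-identityʳ _))) (-‿inverseʳ _))
    cases false true  h = sym (trans (+-cong (-‿inverseʳ _) -0#≈0#) (+-identityʳ _))
    cases false false h = sym (trans (+-cong (trans (+-congˡ -0#≈0#) (+-identityʳ _)) -0#≈0#) (+-identityʳ _))

  -- The second factor on the right sees X and `ι` only through x, a and b. This is what makes
  -- deletions along two different cliques comparable.
  det-deleteEdges : ∀ {m n} (X : Graph n) (Y : Graph m) (ι : Fin m → Fin n) → CliqueEmbedding X ι →
    ∀ s x a b (G : Matrix n n) → pencil 1# x (weighted s X) ⊠ G ≋ 𝟙 →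
    (∀ i j → G (ι i) (ι j) ≈ a * 𝟙 i j + b) →
    det n (pencil 1# x (weighted s (deleteEdges X Y ι))) ≈
    det n (pencil 1# x (weighted s X)) *
    det m (λ i j → (𝟙 ⊞ (x * a) · weighted s Y) i j + ones i * (x * b * columnSum (weighted s Y) j))
  det-deleteEdges {m} {n} X Y ι clique s x a b G BG Gι = begin
    det n (pencil 1# x (weighted s (deleteEdges X Y ι)))
      ≈⟨ det-cong n perturbed ⟩
    det n (B ⊞ extend ι (x · S))
      ≈⟨ det-lowRankUpdate B G (inclusion ι) (x · S) (restriction ι) BG ⟩
    det n B * det m (𝟙 ⊞ (restriction ι ⊠ (G ⊠ inclusion ι)) ⊠ (x · S))
      ≈⟨ *-congˡ (det-constantOffDiagonal _ S x a b (λ i j → trans (restrict-⊠ ι G i j) (Gι i j))) ⟩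
    det n B * det m (λ i j → (𝟙 ⊞ (x * a) · S) i j + ones i * (x * b * columnSum S j)) ∎
    where
    B = pencil 1# x (weighted s X)
    S = weighted s Y
    perturbed : pencil 1# x (weighted s (deleteEdges X Y ι)) ≋ B ⊞ extend ι (x · S)
    perturbed u v = begin
      1# * 𝟙 u v - x * weighted s (deleteEdges X Y ι) u v
        ≈⟨ +-congˡ (-‿cong (*-congˡ (weighted-deleteEdges X Y ι clique s u v))) ⟩
      1# * 𝟙 u v - x * (weighted s X u v - extend ι S u v)
        ≈⟨ solve 4 (λ e x w y → e :- x :* (w :- y) := (e :- x :* w) :+ x :* y) refl (1# * 𝟙 u v) x (weighted s X u v) (extend ι S u v) ⟩
      B u v + x * extend ι S u v
        ≈⟨ +-congˡ (extend-· ι x S u v) ⟨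
      B u v + extend ι (x · S) u v ∎

  pencil-neg : ∀ {n} α (K : Matrix n n) → pencil 1# (- α) K ≋ 𝟙 ⊞ α · K
  pencil-neg α K i j = +-cong (*-identityˡ _) (trans (-‿cong (sym (-‿distribˡ-* _ _))) (-‿involutive _))

  pencil-cong : ∀ {n} u v {K K′ : Matrix n n} → K ≋ K′ → pencil u v K ≋ pencil u v K′
  pencil-cong u v e i j = +-congˡ (-‿cong (*-congˡ (e i j)))

  -- Degrees of a graph and its complement add up to n - 1 and adjacency matrices to J - I, so the
  -- unsigned Laplacians add up to (n - 2) I + J. Here n appears in the ring as a sum of ones.
  pencil-complement : ∀ {n} (G : Graph n) α →
    pencil (1# + α * (∑[ i < n ] 1# - 1# - 1#)) α (weighted 1# (complement G)) ≋ λ i j → (𝟙 ⊞ α · weighted 1# G) i j - α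
  pencil-complement {n} G α i j = begin
    (1# + α * (μ - 1# - 1#)) * 𝟙 i j - α * (𝟙 i j * rowSum (adjacency (complement G)) i + 1# * adjacency (complement G) i j)
      ≈⟨ +-congˡ (-‿cong (*-congˡ (+-cong (*-congˡ rowSum-complement) (*-congˡ (adjacency-complement G i j))))) ⟩
    (1# + α * (μ - 1# - 1#)) * 𝟙 i j - α * (𝟙 i j * (μ - 1# - rowSum (adjacency G) i) + 1# * (1# - 𝟙 i j - adjacency G i j))
      -- The ring solver has integer constants, so each 1 is first rewritten as the image of the
      -- integer 1.
      ≈⟨ +-cong (*-congʳ (+-cong 1≈ (*-congˡ (+-cong (+-congˡ (-‿cong 1≈)) (-‿cong 1≈)))))
           (-‿cong (*-congˡ (+-cong (*-congˡ (+-congʳ (+-congˡ (-‿cong 1≈)))) (*-cong 1≈ (+-congʳ (+-congʳ 1≈)))))) ⟩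
    _ ≈⟨ solve 5 (λ α μ e r a →
           (con 1ℤ :+ α :* (μ :- con 1ℤ :- con 1ℤ)) :* e :- α :* (e :* (μ :- con 1ℤ :- r) :+ con 1ℤ :* (con 1ℤ :- e :- a))
           := (e :+ α :* (e :* r :+ con 1ℤ :* a)) :- α) refl α μ (𝟙 i j) (rowSum (adjacency G) i) (adjacency G i j) ⟩
    _ ≈⟨ +-congʳ (+-congˡ (*-congˡ (+-congˡ (*-congʳ 1≈)))) ⟨
    (𝟙 i j + α * weighted 1# G i j) - α ∎
    where
    μ = ∑[ i < n ] 1#
    1≈ : 1# ≈ ⟦ 1ℤ ⟧
    1≈ = sym 1#-homo
    rowSum-complement : rowSum (adjacency (complement G)) i ≈ μ - 1# - rowSum (adjacency G) i
    rowSum-complement = begin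
      ∑[ j < n ] adjacency (complement G) i j
        ≈⟨ sum-cong-≋ {n} (λ j → trans (adjacency-complement G i j) (+-cong (+-congˡ (sym (-1*x≈-x _))) (sym (-1*x≈-x _)))) ⟩
      ∑[ j < n ] (1# + - 1# * 𝟙 i j + - 1# * adjacency G i j)
        ≈⟨ ∑-distrib-+ (λ j → 1# + - 1# * 𝟙 i j) (λ j → - 1# * adjacency G i j) ⟩
      ∑[ j < n ] (1# + - 1# * 𝟙 i j) + ∑[ j < n ] (- 1# * adjacency G i j)
        ≈⟨ +-cong (trans (∑-distrib-+ {n} (λ j → 1#) (λ j → - 1# * 𝟙 i j)) (+-congˡ (negSum (𝟙 i)))) (negSum (adjacency G i)) ⟩
      μ - rowSum 𝟙 i - rowSum (adjacency G) i
        ≈⟨ +-congʳ (+-congˡ (-‿cong (rowSum-𝟙 i))) ⟩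
      μ - 1# - rowSum (adjacency G) i ∎
      where
      negSum : ∀ f → ∑[ j < n ] (- 1# * f j) ≈ - ∑[ j < n ] f j
      negSum f = trans (sym (*-distribˡ-sum (- 1#) f)) (-1*x≈-x _)

  module _ {m n} (X : Graph n) (Y₁ Y₂ : Graph m) (ι₁ ι₂ : Fin m → Fin n)
    (clique₁ : CliqueEmbedding X ι₁) (clique₂ : CliqueEmbedding X ι₂) (x a b : Carrier) (G : Matrix n n)
    (Gι₁ : ∀ i j → G (ι₁ i) (ι₁ j) ≈ a * 𝟙 i j + b) (Gι₂ : ∀ i j → G (ι₂ i) (ι₂ j) ≈ a * 𝟙 i j + b) where

    det-deleteEdges-laplacian : pencil 1# x (image (laplacian X)) ⊠ G ≋ 𝟙 → LaplacianCospectral Y₁ Y₂ →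
      det n (pencil 1# x (image (laplacian (deleteEdges X Y₁ ι₁)))) ≈
      det n (pencil 1# x (image (laplacian (deleteEdges X Y₂ ι₂))))
    det-deleteEdges-laplacian BG cospectral = begin
      det n (pencil 1# x (image (laplacian (deleteEdges X Y₁ ι₁))))
        ≈⟨ det-cong n (pencil-cong 1# x (⟦laplacian⟧ (deleteEdges X Y₁ ι₁))) ⟩
      det n (pencil 1# x (weighted s (deleteEdges X Y₁ ι₁)))
        ≈⟨ det-deleteEdges X Y₁ ι₁ clique₁ s x a b G BG′ Gι₁ ⟩
      det n (pencil 1# x (weighted s X)) * _
        ≈⟨ *-congˡ (trans (det-flat Y₁) (trans
             (det-pencil-cong 1# (- (x * a)) m {laplacian Y₁} {laplacian Y₂} cospectral) (sym (det-flat Y₂)))) ⟩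
      det n (pencil 1# x (weighted s X)) * _
        ≈⟨ det-deleteEdges X Y₂ ι₂ clique₂ s x a b G BG′ Gι₂ ⟨
      det n (pencil 1# x (weighted s (deleteEdges X Y₂ ι₂)))
        ≈⟨ det-cong n (pencil-cong 1# x (⟦laplacian⟧ (deleteEdges X Y₂ ι₂))) ⟨
      det n (pencil 1# x (image (laplacian (deleteEdges X Y₂ ι₂)))) ∎
      where
      s = - 1#
      BG′ : pencil 1# x (weighted s X) ⊠ G ≋ 𝟙
      BG′ i j = trans (⊠-congʳ G (pencil-cong 1# x (λ i j → sym (⟦laplacian⟧ X i j))) i j) (BG i j)
      -- Zero column sums kill the rank-one term, whatever b is; what remains is the characteristic
      -- polynomial of Y at the point (1, -x a).
      det-flat : ∀ Y → det m (λ i j → (𝟙 ⊞ (x * a) · weighted s Y) i j + ones i * (x * b * columnSum (weighted s Y) j)) ≈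
        det m (pencil 1# (- (x * a)) (image (laplacian Y)))
      det-flat Y = det-cong m λ i j → begin
        (𝟙 ⊞ (x * a) · weighted s Y) i j + 1# * (x * b * columnSum (weighted s Y) j)
          ≈⟨ +-congˡ (trans (*-identityˡ _) (trans (*-congˡ (columnSum-laplacian Y j)) (zeroʳ _))) ⟩
        (𝟙 ⊞ (x * a) · weighted s Y) i j + 0#
          ≈⟨ +-identityʳ _ ⟩
        (𝟙 ⊞ (x * a) · weighted s Y) i j
          ≈⟨ pencil-neg (x * a) (weighted s Y) i j ⟨
        pencil 1# (- (x * a)) (weighted s Y) i j
          ≈⟨ pencil-cong 1# (- (x * a)) (⟦laplacian⟧ Y) i j ⟨
        pencil 1# (- (x * a)) (image (laplacian Y)) i j ∎

    det-deleteEdges-signless : pencil 1# x (image (signlessLaplacian X)) ⊠ G ≋ 𝟙 →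
      (∀ y z → x * a * y ≈ x * a * z → y ≈ z) →
      UnsignedLaplacianCospectral Y₁ Y₂ → UnsignedLaplacianCospectral (complement Y₁) (complement Y₂) →
      det n (pencil 1# x (image (signlessLaplacian (deleteEdges X Y₁ ι₁)))) ≈
      det n (pencil 1# x (image (signlessLaplacian (deleteEdges X Y₂ ι₂))))
    det-deleteEdges-signless BG cancel cospectral cospectralᶜ = begin
      det n (pencil 1# x (image (signlessLaplacian (deleteEdges X Y₁ ι₁))))
        ≈⟨ det-cong n (pencil-cong 1# x (⟦signlessLaplacian⟧ (deleteEdges X Y₁ ι₁))) ⟩
      det n (pencil 1# x (weighted 1# (deleteEdges X Y₁ ι₁)))
        ≈⟨ det-deleteEdges X Y₁ ι₁ clique₁ 1# x a b G BG′ Gι₁ ⟩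
      det n (pencil 1# x (weighted 1# X)) * _
        ≈⟨ *-congˡ (det-columnSum-determined α (x * b) (weighted 1# Y₁) (weighted 1# Y₂) cancel
             (trans (det-N Y₁) (trans (det-pencil-cong 1# (- α) m {signlessLaplacian Y₁} {signlessLaplacian Y₂} cospectral) (sym (det-N Y₂))))
             (trans (det-Nᶜ Y₁) (trans
               (det-pencil-cong κ α m {signlessLaplacian (complement Y₁)} {signlessLaplacian (complement Y₂)} cospectralᶜ) (sym (det-Nᶜ Y₂))))) ⟩
      det n (pencil 1# x (weighted 1# X)) * _
        ≈⟨ det-deleteEdges X Y₂ ι₂ clique₂ 1# x a b G BG′ Gι₂ ⟨
      det n (pencil 1# x (weighted 1# (deleteEdges X Y₂ ι₂)))
        ≈⟨ det-cong n (pencil-cong 1# x (⟦signlessLaplacian⟧ (deleteEdges X Y₂ ι₂))) ⟨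
      det n (pencil 1# x (image (signlessLaplacian (deleteEdges X Y₂ ι₂)))) ∎
      where
      α = x * a
      κ = 1# + α * (∑[ i < m ] 1# - 1# - 1#)
      BG′ : pencil 1# x (weighted 1# X) ⊠ G ≋ 𝟙
      BG′ i j = trans (⊠-congʳ G (pencil-cong 1# x (λ i j → sym (⟦signlessLaplacian⟧ X i j))) i j) (BG i j)
      det-N : ∀ Y → det m (𝟙 ⊞ α · weighted 1# Y) ≈ det m (pencil 1# (- α) (image (signlessLaplacian Y)))
      det-N Y = det-cong m λ i j →
        sym (trans (pencil-cong 1# (- α) (⟦signlessLaplacian⟧ Y) i j) (pencil-neg α (weighted 1# Y) i j))
      det-Nᶜ : ∀ Y → det m (λ i j → (𝟙 ⊞ α · weighted 1# Y) i j - α) ≈ det m (pencil κ α (image (signlessLaplacian (complement Y))))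
      det-Nᶜ Y = det-cong m λ i j →
        sym (trans (pencil-cong κ α (⟦signlessLaplacian⟧ (complement Y)) i j) (pencil-complement Y α i j))

-- The resolvent of a 1-walk regular graph

sumℕ-cong : ∀ {n} {f g : Fin n → ℕ} → (∀ i → f i ≡ g i) → sumℕ f ≡ sumℕ g
sumℕ-cong {zero}  e = ≡.refl
sumℕ-cong {suc n} e = cong₂ ℕ._+_ (e zero) (sumℕ-cong (e ∘ suc))

sumℕ-zero : ∀ {n} (f : Fin n → ℕ) → (∀ i → f i ≡ 0) → sumℕ f ≡ 0
sumℕ-zero {zero}  f e = ≡.refl
sumℕ-zero {suc n} f e = cong₂ ℕ._+_ (e zero) (sumℕ-zero (f ∘ suc) (e ∘ suc))

sumℕ-== : ∀ {n} (f : Fin n → ℕ) u → sumℕ (λ w → f w ℕ.* b2n (w == u)) ≡ f u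
sumℕ-== {suc n} f zero    = ≡.trans (cong₂ ℕ._+_ (ℕ.*-identityʳ (f zero)) (sumℕ-zero _ (λ i → ℕ.*-zeroʳ (f (suc i)))))
  (ℕ.+-identityʳ (f zero))
sumℕ-== {suc n} f (suc u) = cong₂ ℕ._+_ (ℕ.*-zeroʳ (f zero)) (sumℕ-== (f ∘ suc) u)

walks-2 : ∀ {n} (X : Graph n) u → walks X 2 u u ≡ degree X u
walks-2 X u = sumℕ-cong λ w → ≡.trans
  (cong (b2n (adj X u w) ℕ.*_) (≡.trans (sumℕ-== (λ x → b2n (adj X w x)) u) (cong b2n (Graph.sym X w u))))
  (b2n-idem (adj X u w))
  where
  b2n-idem : ∀ b → b2n b ℕ.* b2n b ≡ b2n b
  b2n-idem true  = ≡.refl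
  b2n-idem false = ≡.refl

-- Closed walks of length 2 at a vertex count its degree. A graph without vertices has no degree to
-- read off, and 0 serves as a default.
regular : ∀ {n} (X : Graph n) → OneWalkRegular X → ∃ λ k → ∀ u → degree X u ≡ k
regular {zero}  X _           = 0 , λ ()
regular {suc n} X (closed , _) = degree X zero , λ u →
  ≡.trans (≡.sym (walks-2 X u)) (≡.trans (closed 2 (s≤s z≤n) u zero) (walks-2 X zero))

module Resolvent {n} (X : Graph n) (walkRegular : OneWalkRegular X) (s : ℤ) where
  open import Data.Integer using (_+_; _*_)
  open import Algebra.Properties.Semiring.Sum (CommutativeRing.semiring ℤ.+-*-commutativeRing)

  k : ℤ
  k = ℤ.+ proj₁ (regular X walkRegular)

  -- mixedWalks j i u v is the (u,v) entry of (k I + s A)ʲ Aⁱ.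
  mixedWalks : ℕ → ℕ → Fin n → Fin n → ℤ
  mixedWalks zero    i u v = ℤ.+ walks X i u v
  mixedWalks (suc j) i u v = k * mixedWalks j i u v + s * mixedWalks j (suc i) u v

  +-sumℕ : ∀ {m} (f : Fin m → ℕ) → ℤ.+ sumℕ f ≡ ∑[ i < m ] (ℤ.+ f i)
  +-sumℕ {zero}  f = ≡.refl
  +-sumℕ {suc m} f = cong ((ℤ.+ f zero) +_) (+-sumℕ (f ∘ suc))

  -- A commutes with k I + s A, so the extra factor A may be placed on the left, where `walks` takes
  -- its first step.
  mixedWalks-step : ∀ j i u v → mixedWalks j (suc i) u v ≡ ∑[ w < n ] (adjℤ X u w * mixedWalks j i w v)
  mixedWalks-step zero i u v = ≡.trans (+-sumℕ (λ w → b2n (adj X u w) ℕ.* walks X i w v))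
    (sum-cong-≋ {n} λ w → ℤ.pos-* (b2n (adj X u w)) (walks X i w v))
  mixedWalks-step (suc j) i u v = begin
    k * mixedWalks j (suc i) u v + s * mixedWalks j (suc (suc i)) u v
      ≡⟨ cong₂ (λ x y → k * x + s * y) (mixedWalks-step j i u v) (mixedWalks-step j (suc i) u v) ⟩
    k * ∑[ w < n ] f w + s * ∑[ w < n ] g w
      ≡⟨ cong₂ _+_ (*-distribˡ-sum k f) (*-distribˡ-sum s g) ⟩
    ∑[ w < n ] (k * f w) + ∑[ w < n ] (s * g w)
      ≡⟨ ∑-distrib-+ (λ w → k * f w) (λ w → s * g w) ⟨
    ∑[ w < n ] (k * f w + s * g w)
      ≡⟨ sum-cong-≋ {n} (λ w → rearrange k s (adjℤ X u w) (mixedWalks j i w v) (mixedWalks j (suc i) w v)) ⟩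
    ∑[ w < n ] (adjℤ X u w * mixedWalks (suc j) i w v) ∎
    where
    open ≡-Reasoning
    f g : Fin n → ℤ
    f w = adjℤ X u w * mixedWalks j i w v
    g w = adjℤ X u w * mixedWalks j (suc i) w v
    rearrange : ∀ k s a x y → k * (a * x) + s * (a * y) ≡ a * (k * x + s * y)
    rearrange = solve-∀

  -- Each entry is a combination of walk counts; the index i lets the induction on j reach longer
  -- walks. Regularity speaks of positive lengths, so length 0 is settled separately.
  mixedWalks-diagonal : ∀ j i u v → mixedWalks j i u u ≡ mixedWalks j i v v
  mixedWalks-diagonal zero    zero    u v = cong (ℤ.+_ ∘ b2n) (≡.trans (==-refl u) (≡.sym (==-refl v)))
  mixedWalks-diagonal zero    (suc i) u v = cong ℤ.+_ (proj₁ walkRegular (suc i) (s≤s z≤n) u v)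
  mixedWalks-diagonal (suc j) i       u v =
    cong₂ (λ x y → k * x + s * y) (mixedWalks-diagonal j i u v) (mixedWalks-diagonal j (suc i) u v)

  Adj⇒≢ : ∀ {u v} → Adj X u v → u ≢ v
  Adj⇒≢ {u} e ≡.refl = contradiction (≡.trans (≡.sym e) (irrefl X u)) λ ()

  -- As on the diagonal, with length 0 giving the value 0, because adjacent vertices are distinct.
  mixedWalks-edge : ∀ j i {u v u′ v′} → Adj X u v → Adj X u′ v′ → mixedWalks j i u v ≡ mixedWalks j i u′ v′
  mixedWalks-edge zero    zero    e e′ = cong (ℤ.+_ ∘ b2n) (≡.trans (==-≢ (Adj⇒≢ e)) (≡.sym (==-≢ (Adj⇒≢ e′))))
  mixedWalks-edge zero    (suc i) e e′ = cong ℤ.+_ (proj₂ walkRegular (suc i) (s≤s z≤n) _ _ _ _ e e′)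
  mixedWalks-edge (suc j) i       e e′ =
    cong₂ (λ x y → k * x + s * y) (mixedWalks-edge j i e e′) (mixedWalks-edge j (suc i) e e′)

  -- The coefficient of tʲ is the (u, v) entry of (k I + s A)ʲ; since X is regular, this is the j-th
  -- power of D + s A.
  resolvent : Fin n → Fin n → Series
  resolvent u v j = mixedWalks j 0 u v

  degℤ-regular : ∀ u v → degℤ X u v ≡ δ u v * k
  degℤ-regular u v with u == v
  ... | true  = ≡.trans (cong ℤ.+_ (proj₂ (regular X walkRegular) u)) (≡.sym (ℤ.*-identityˡ k))
  ... | false = ≡.refl

  mixedWalks-suc : ∀ j u v → mixedWalks (suc j) 0 u v ≡ ∑[ w < n ] ((degℤ X u w + s * adjℤ X u w) * mixedWalks j 0 w v)
  mixedWalks-suc j u v = begin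
    k * mixedWalks j 0 u v + s * mixedWalks j 1 u v
      ≡⟨ cong₂ (λ x y → k * x + s * y) (≡.sym (sum-𝟙ˡ (λ w → mixedWalks j 0 w v) u)) (mixedWalks-step j 0 u v) ⟩
    k * ∑[ w < n ] f w + s * ∑[ w < n ] g w
      ≡⟨ cong₂ _+_ (*-distribˡ-sum k f) (*-distribˡ-sum s g) ⟩
    ∑[ w < n ] (k * f w) + ∑[ w < n ] (s * g w)
      ≡⟨ ∑-distrib-+ (λ w → k * f w) (λ w → s * g w) ⟨
    ∑[ w < n ] (k * f w + s * g w)
      ≡⟨ sum-cong-≋ {n} (λ w → ≡.trans (rearrange k s (δ u w) (adjℤ X u w) (mixedWalks j 0 w v))
           (cong (λ d → (d + s * adjℤ X u w) * mixedWalks j 0 w v) (≡.sym (degℤ-regular u w)))) ⟩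
    ∑[ w < n ] ((degℤ X u w + s * adjℤ X u w) * mixedWalks j 0 w v) ∎
    where
    open ≡-Reasoning
    open LinearAlgebra ℤ.+-*-commutativeRing using (sum-𝟙ˡ)
    f g : Fin n → ℤ
    f w = δ u w * mixedWalks j 0 w v
    g w = adjℤ X u w * mixedWalks j 0 w v
    rearrange : ∀ k s e a x → k * (e * x) + s * (a * x) ≡ (e * k + s * a) * x
    rearrange = solve-∀

  module S = CommutativeRing seriesRing
  open LinearAlgebra seriesRing
  open Pencil seriesRing const const-isHom
  open import Algebra.Properties.Ring S.ring using (-‿distribˡ-*)
  import Algebra.Properties.Semiring.Sum S.semiring as SeriesSum

  module _ (K : Fin n → Fin n → ℤ) (K≡ : ∀ u w → K u w ≡ degℤ X u w + s * adjℤ X u w) where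

    image-⊠-resolvent : ∀ u v j → (image K ⊠ resolvent) u v j ≡ mixedWalks (suc j) 0 u v
    image-⊠-resolvent u v j = ≡.trans (sum-eval (λ w → const (K u w) ⋆ resolvent w v))
      (≡.trans (sum-cong-≋ {n} λ w → ≡.trans (const-⋆ (K u w) (resolvent w v) j) (cong (_* mixedWalks j 0 w v) (K≡ u w)))
        (≡.sym (mixedWalks-suc j u v)))
      where
      sum-eval : ∀ {m} (f : Fin m → Series) → SeriesSum.sum f j ≡ ∑[ i < m ] f i j
      sum-eval {zero}  f = ≡.refl
      sum-eval {suc m} f = cong (f zero j +_) (sum-eval (f ∘ suc))

    -- G = I + t K G read coefficientwise: the constant term is K⁰ = I, and the later ones say that
    -- Kʲ⁺¹ = K Kʲ.
    resolvent-fixpoint : ∀ u v → resolvent u v ≗ 𝟙 u v ⊕ t ⋆ (image K ⊠ resolvent) u v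
    resolvent-fixpoint u v zero    = ≡.trans (start u v) (≡.sym (ℤ.+-identityʳ _))
      where
      start : ∀ u v → ℤ.+ b2n (u == v) ≡ 𝟙 u v 0
      start u v with u == v
      ... | true  = ≡.refl
      ... | false = ≡.refl
    resolvent-fixpoint u v (suc j) = ≡.sym (≡.trans (cong₂ _+_ (𝟙-suc u v) (≡.trans (t⋆-suc _ j) (image-⊠-resolvent u v j)))
      (ℤ.+-identityˡ _))
      where
      𝟙-suc : ∀ u v → 𝟙 u v (suc j) ≡ 0ℤ
      𝟙-suc u v with u == v
      ... | true  = ≡.refl
      ... | false = ≡.refl

    resolvent-inverse : pencil S.1# t (image K) ⊠ resolvent ≋ 𝟙
    resolvent-inverse = pencil-inverse t (image K) resolvent resolvent-fixpoint

  -- With d the common diagonal entry and b the common entry on edges, a = d - b. At t = 0 the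
  -- resolvent is I, so a has constant term 1 - 0. Both cliques share a and b because these are
  -- constant over all of X.
  resolvent-clique : ∀ {m} (ι₁ ι₂ : Fin m → Fin n) → CliqueEmbedding X ι₁ → CliqueEmbedding X ι₂ →
    ∃₂ λ (a b : Series) → a 0 ≡ 1ℤ ×
      (∀ i j → resolvent (ι₁ i) (ι₁ j) ≗ a ⋆ 𝟙 i j ⊕ b) × (∀ i j → resolvent (ι₂ i) (ι₂ j) ≗ a ⋆ 𝟙 i j ⊕ b)
  resolvent-clique {m} ι₁ ι₂ clique₁ clique₂ = d ⊕ ⊖ b , b , cong₂ ℤ._-_ d₀ b₀ , entries ι₁ diag₁ off₁ , entries ι₂ diag₂ off₂
    where
    constants : ∀ {m} (ι₁ ι₂ : Fin m → Fin n) → CliqueEmbedding X ι₁ → CliqueEmbedding X ι₂ →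
      ∃₂ λ (d b : Series) → (d 0 ≡ 1ℤ × b 0 ≡ 0ℤ) × (∀ i → resolvent (ι₁ i) (ι₁ i) ≗ d) × (∀ i → resolvent (ι₂ i) (ι₂ i) ≗ d) ×
        (∀ i j → i ≢ j → resolvent (ι₁ i) (ι₁ j) ≗ b) × (∀ i j → i ≢ j → resolvent (ι₂ i) (ι₂ j) ≗ b)
    -- Cliques with fewer than two vertices offer no edge, and the empty one no vertex. The defaults
    -- b = 0 and d = 1 preserve the constant terms 0 and 1.
    constants {zero} ι₁ ι₂ c₁ c₂ = S.1# , S.0# , (≡.refl , ≡.refl) , (λ ()) , (λ ()) , (λ ()) , (λ ())
    constants {suc zero} ι₁ ι₂ c₁ c₂ = resolvent (ι₁ zero) (ι₁ zero) , S.0# ,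
      (cong (ℤ.+_ ∘ b2n) (==-refl (ι₁ zero)) , ≡.refl) ,
      (λ i j → mixedWalks-diagonal j 0 _ _) , (λ i j → mixedWalks-diagonal j 0 _ _) ,
      (λ { zero zero 0≢0 → contradiction ≡.refl 0≢0 }) , (λ { zero zero 0≢0 → contradiction ≡.refl 0≢0 })
    constants {suc (suc m)} ι₁ ι₂ c₁ c₂ = resolvent (ι₁ zero) (ι₁ zero) , resolvent (ι₁ zero) (ι₁ (suc zero)) ,
      (cong (ℤ.+_ ∘ b2n) (==-refl (ι₁ zero)) , cong (ℤ.+_ ∘ b2n) (==-≢ (Adj⇒≢ edge))) ,
      (λ i j → mixedWalks-diagonal j 0 _ _) , (λ i j → mixedWalks-diagonal j 0 _ _) ,
      (λ i i′ i≢i′ j → mixedWalks-edge j 0 (proj₂ c₁ i i′ i≢i′) edge) ,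
      (λ i i′ i≢i′ j → mixedWalks-edge j 0 (proj₂ c₂ i i′ i≢i′) edge)
      where
      edge : Adj X (ι₁ zero) (ι₁ (suc zero))
      edge = proj₂ c₁ zero (suc zero) λ ()
    c = constants ι₁ ι₂ clique₁ clique₂
    d = proj₁ c
    b = proj₁ (proj₂ c)
    d₀ = proj₁ (proj₁ (proj₂ (proj₂ c)))
    b₀ = proj₂ (proj₁ (proj₂ (proj₂ c)))
    diag₁ = proj₁ (proj₂ (proj₂ (proj₂ c)))
    diag₂ = proj₁ (proj₂ (proj₂ (proj₂ (proj₂ c))))
    off₁ = proj₁ (proj₂ (proj₂ (proj₂ (proj₂ (proj₂ c)))))
    off₂ = proj₂ (proj₂ (proj₂ (proj₂ (proj₂ (proj₂ c)))))
    entries : ∀ (ι : Fin m → Fin n) → (∀ i → resolvent (ι i) (ι i) ≗ d) → (∀ i j → i ≢ j → resolvent (ι i) (ι j) ≗ b) →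
      ∀ i j → resolvent (ι i) (ι j) ≗ (d ⊕ ⊖ b) ⋆ 𝟙 i j ⊕ b
    entries ι diag off i j with i ≟ j
    ... | yes ≡.refl = λ l → ≡.trans (diag i l) (≡.sym (≡.trans (cong (_+ b l) (S.*-identityʳ (d ⊕ ⊖ b) l)) (recombine (d l) (b l))))
      where
      recombine : ∀ x y → (x ℤ.- y) + y ≡ x
      recombine = solve-∀
    ... | no i≢j = λ l → ≡.trans (off i j i≢j l) (≡.sym (≡.trans (cong (_+ b l) (S.zeroʳ (d ⊕ ⊖ b) l)) (ℤ.+-identityˡ (b l))))

theorem6p1 : ∀ {n} (X : Graph n) (ω : ℕ) → OneWalkRegular X → CliqueNumber X ω →
    (∀ {m₁ m₂} (Y₁ : Graph m₁) (Y₂ : Graph m₂) → m₁ ≤ ω → m₂ ≤ ω →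
    LaplacianCospectral Y₁ Y₂ →
    (ι₁ : Fin m₁ → Fin n) (ι₂ : Fin m₂ → Fin n) →
    CliqueEmbedding X ι₁ → CliqueEmbedding X ι₂ →
    LaplacianCospectral (deleteEdges X Y₁ ι₁) (deleteEdges X Y₂ ι₂))
    ×
    (∀ {m₁ m₂} (Y₁ : Graph m₁) (Y₂ : Graph m₂) → m₁ ≤ ω → m₂ ≤ ω →
    UnsignedLaplacianCospectral Y₁ Y₂ →
    UnsignedLaplacianCospectral (complement Y₁) (complement Y₂) →
    (ι₁ : Fin m₁ → Fin n) (ι₂ : Fin m₂ → Fin n) →
    CliqueEmbedding X ι₁ → CliqueEmbedding X ι₂ →
    UnsignedLaplacianCospectral (deleteEdges X Y₁ ι₁) (deleteEdges X Y₂ ι₂))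
theorem6p1 {n} X ω walkRegular _ = partA , partB
  where
  open GraphMatrices seriesRing const const-isHom
  partA : ∀ {m₁ m₂} (Y₁ : Graph m₁) (Y₂ : Graph m₂) → m₁ ≤ ω → m₂ ≤ ω →
    LaplacianCospectral Y₁ Y₂ →
    (ι₁ : Fin m₁ → Fin n) (ι₂ : Fin m₂ → Fin n) →
    CliqueEmbedding X ι₁ → CliqueEmbedding X ι₂ →
    LaplacianCospectral (deleteEdges X Y₁ ι₁) (deleteEdges X Y₂ ι₂)
  partA {m₁} {m₂} Y₁ Y₂ _ _ cospectral ι₁ ι₂ clique₁ clique₂
    -- Cospectrality identifies the two sizes, so that both perturbations are compared through
    -- matrices of one size m.
    with ≡.refl ← charPoly-size m₁ m₂ (laplacian Y₁) (laplacian Y₂) cospectral =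
    let open Resolvent X walkRegular ℤ.-1ℤ
        a , b , _ , clique₁-entries , clique₂-entries = resolvent-clique ι₁ ι₂ clique₁ clique₂
    in charPoly-from-pencil n (laplacian (deleteEdges X Y₁ ι₁)) (laplacian (deleteEdges X Y₂ ι₂))
      (det-deleteEdges-laplacian X Y₁ Y₂ ι₁ ι₂ clique₁ clique₂ t a b resolvent clique₁-entries clique₂-entries
        (resolvent-inverse (laplacian X) (λ u w → cong (λ x → degℤ X u w ℤ.+ x) (≡.sym (ℤ.-1*i≡-i (adjℤ X u w)))))
        cospectral)
  partB : ∀ {m₁ m₂} (Y₁ : Graph m₁) (Y₂ : Graph m₂) → m₁ ≤ ω → m₂ ≤ ω →
    UnsignedLaplacianCospectral Y₁ Y₂ →
    UnsignedLaplacianCospectral (complement Y₁) (complement Y₂) →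
    (ι₁ : Fin m₁ → Fin n) (ι₂ : Fin m₂ → Fin n) →
    CliqueEmbedding X ι₁ → CliqueEmbedding X ι₂ →
    UnsignedLaplacianCospectral (deleteEdges X Y₁ ι₁) (deleteEdges X Y₂ ι₂)
  partB {m₁} {m₂} Y₁ Y₂ _ _ cospectral cospectralᶜ ι₁ ι₂ clique₁ clique₂
    with ≡.refl ← charPoly-size m₁ m₂ (signlessLaplacian Y₁) (signlessLaplacian Y₂) cospectral =
    let open Resolvent X walkRegular 1ℤ
        a , b , a₀ , clique₁-entries , clique₂-entries = resolvent-clique ι₁ ι₂ clique₁ clique₂
    in charPoly-from-pencil n (signlessLaplacian (deleteEdges X Y₁ ι₁)) (signlessLaplacian (deleteEdges X Y₂ ι₂))
      (det-deleteEdges-signless X Y₁ Y₂ ι₁ ι₂ clique₁ clique₂ t a b resolvent clique₁-entries clique₂-entries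
        (resolvent-inverse (signlessLaplacian X) (λ u w → cong (λ x → degℤ X u w ℤ.+ x) (≡.sym (ℤ.*-identityˡ (adjℤ X u w)))))
        -- The constant term 1 of a makes α = t a cancellable.
        (λ y z → t⋆-cancel a y z a₀) cospectral cospectralᶜ)
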